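{- The problems U$\exists\forall$-Sat and WDom-Strategy are polynomial-time (many-one) equivalent, i.e., each is polynomial-time many-one reducible to the other.
   Context: $\Vert$ denotes concatenation of bit strings; circuit outputs are compared as binary numbers. U$\exists\forall$-Sat: the input consists of two sets $\mathcal{X}=\{x_1,\dots,x_n\}$ and $\mathcal{Y}=\{y_1,\dots,y_n\}$ of Boolean variables and a Boolean formula $\psi$ over $\mathcal{X}\cup\mathcal{Y}$; the question is whether there is exactly one $x^*\in\{0,1\}^n$ such that for all $y'\in\{0,1\}^n$ we have $\psi(x^*\Vert y')=1$. WDom-Strategy (Weak-Dominant-Strategy): the input is a Boolean circuit $C\colon\{0,1\}^{2n}\to\{0,1\}^n$; the question is whether there exists $x\in\{0,1\}^n$ such that for all $x',y\in\{0,1\}^n$ with $x'\neq x$ there exists $y'\in\{0,1\}^n$ with $C(x\Vert y)\geq C(x'\Vert y)$ and $C(x\Vert y')>C(x'\Vert y')$. -}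

module Defs where

open import Data.Bool using (Bool; true; false; not; _∧_; _∨_)
open import Data.Fin using (Fin; zero; toℕ)
open import Data.Fin.Properties using (toℕ-injective)
open import Data.List using (List; []; _∷_; _++_; length; map; concatMap)
open import Data.List.Properties using (++-assoc; ∷-injectiveʳ)
import Data.Maybe as Maybe
open import Data.Maybe using (Maybe; just; nothing; maybe′)
open import Data.Nat using (ℕ; suc; _+_; _*_; _^_; _≤_; _≥_; _>_)
open import Data.Product using (Σ; ∃₂; ∃-syntax; ∃!; _×_; _,_; proj₁; proj₂)
open import Data.Sum using (_⊎_; inj₁; inj₂; [_,_])
import Data.Vec as Vec
open import Data.Vec using (Vec; []; _∷_; lookup; _∷ʳ_; zipWith)
open import Function using (_↔_; _⇔_; Injective)
open import Relation.Binary.PropositionalEquality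
  using (_≡_; _≢_; refl; sym; trans; cong; module ≡-Reasoning)

private
  variable
    A V : Set
    m n : ℕ

------------------------------------------------------------------------
-- Multi-tape Turing machines

-- `nothing` is the blank.
Symbol : Set
Symbol = Maybe Bool

data Move : Set where
  left stay right : Move

-- A two-way infinite tape. Both lists start at the cell next to the head, and
-- the cells beyond their ends are blank.
record Tape : Set where
  constructor tape
  field
    lefts  : List Symbol
    head   : Symbol
    rights : List Symbol

open Tape public

blankTape : Tape
blankTape = tape [] nothing []

moveLeft : Tape → Tape
moveLeft (tape []       a rs) = tape [] nothing (a ∷ rs)
moveLeft (tape (l ∷ ls) a rs) = tape ls l       (a ∷ rs)

moveRight : Tape → Tape
moveRight (tape ls a [])       = tape (a ∷ ls) nothing []
moveRight (tape ls a (r ∷ rs)) = tape (a ∷ ls) r       rs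

move : Move → Tape → Tape
move left  t = moveLeft t
move stay  t = t
move right t = moveRight t

-- Write a symbol, then move.
act : Symbol × Move → Tape → Tape
act (a , d) t = move d (record t { head = a })

-- The machine halts when the transition function returns `nothing`.
record TM : Set₁ where
  field
    extraTapes : ℕ

  tapes : ℕ
  tapes = suc extraTapes

  field
    State  : Set
    finite : ∃[ q ] (State ↔ Fin q)
    start  : State
    δ      : State → Vec Symbol tapes → Maybe (State × Vec (Symbol × Move) tapes)

  Config : Set
  Config = State × Vec Tape tapes

  step : Config → Maybe Config
  step (s , ts) = Maybe.map
    (λ (s′ , as) → s′ , zipWith act as ts)
    (δ s (Vec.map head ts))

  -- The configuration after the given number of steps; a halted machine stays
  -- where it is.
  run : ℕ → Config → Config
  run ℕ.zero  c = c
  run (suc t) c = maybe′ (run t) c (step c)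

-- The head is on the first symbol of the word.
load : List Bool → Tape
load []       = blankTape
load (b ∷ bs) = tape [] (just b) (map just bs)

leadingBits : List Symbol → List Bool
leadingBits (just b ∷ as) = b ∷ leadingBits as
leadingBits _             = []

-- The word that starts under the head and ends before the first blank.
readOut : Tape → List Bool
readOut t = leadingBits (head t ∷ rights t)

-- Input and output are both on the first tape; all other tapes start blank.
Computes_↦_within : TM → List Bool → List Bool → ℕ → Set
Computes_↦_within M u v t =
  let open TM M
      final = run t (start , load u ∷ Vec.replicate extraTapes blankTape)
  in step final ≡ nothing × readOut (lookup (proj₂ final) zero) ≡ v

------------------------------------------------------------------------
-- Decision problems and reductions

record Problem : Set₁ where
  field
    Instance         : Set
    Yes              : Instance → Set
    encode           : Instance → List Bool
    encode-injective : Injective _≡_ _≡_ encode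

open Problem public using (Instance; Yes; encode)

PolynomialTime : (P Q : Problem) → (Instance P → Instance Q) → Set₁
PolynomialTime P Q f =
  Σ TM λ M → ∃₂ λ (c d : ℕ) → ∀ i → ∃[ t ]
    t ≤ c * length (encode P i) ^ d + c ×
    Computes M ↦ encode P i within (encode Q (f i)) t

infix 4 _≤ₚ_ _≡ₚ_

_≤ₚ_ : Problem → Problem → Set₁
P ≤ₚ Q = Σ (Instance P → Instance Q) λ f →
  PolynomialTime P Q f × (∀ i → Yes P i ⇔ Yes Q (f i))

_≡ₚ_ : Problem → Problem → Set₁
P ≡ₚ Q = (P ≤ₚ Q) × (Q ≤ₚ P)

------------------------------------------------------------------------
-- Uniquely decodable encodings

Word : Set
Word = List Bool

PrefixFree : (A → Word) → Set
PrefixFree e = ∀ a b {u v} → e a ++ u ≡ e b ++ v → a ≡ b × u ≡ v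

prefixFree⇒injective : {e : A → Word} → PrefixFree e → Injective _≡_ _≡_ e
prefixFree⇒injective pf {a} {b} eq = proj₁ (pf a b (cong (_++ []) eq))

reassoc : ∀ (a b : Word) {c d u v : Word} →
          (a ++ c) ++ u ≡ (b ++ d) ++ v → a ++ (c ++ u) ≡ b ++ (d ++ v)
reassoc a b {c} {d} {u} {v} eq =
  trans (sym (++-assoc a c u)) (trans eq (++-assoc b d v))

unary : ℕ → Word
unary ℕ.zero  = false ∷ []
unary (suc i) = true ∷ unary i

unary-prefixFree : PrefixFree unary
unary-prefixFree ℕ.zero  ℕ.zero  refl = refl , refl
unary-prefixFree (suc i) (suc j) eq
  with refl , p ← unary-prefixFree i j (∷-injectiveʳ eq) = refl , p

-- Indices in unary: no index exceeds the total number of variables or wires,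
-- so this costs at most a polynomial factor over binary.
encodeFin : Fin n → Word
encodeFin i = unary (toℕ i)

encodeFin-prefixFree : PrefixFree (encodeFin {n})
encodeFin-prefixFree i j eq with p , q ← unary-prefixFree (toℕ i) (toℕ j) eq =
  toℕ-injective p , q

------------------------------------------------------------------------
-- Boolean formulas

infixr 6 _∧′_
infixr 5 _∨′_

data Formula (V : Set) : Set where
  var       : V → Formula V
  ¬′_       : Formula V → Formula V
  _∧′_ _∨′_ : Formula V → Formula V → Formula V

eval : (V → Bool) → Formula V → Bool
eval ρ (var v)  = ρ v
eval ρ (¬′ φ)   = not (eval ρ φ)
eval ρ (φ ∧′ χ) = eval ρ φ ∧ eval ρ χ
eval ρ (φ ∨′ χ) = eval ρ φ ∨ eval ρ χ

data Token (V : Set) : Set where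
  var         : V → Token V
  neg and or : Token V

-- Reverse Polish notation.
postfix : Formula V → List (Token V)
postfix (var v)  = var v ∷ []
postfix (¬′ φ)   = postfix φ ++ neg ∷ []
postfix (φ ∧′ χ) = postfix φ ++ postfix χ ++ and ∷ []
postfix (φ ∨′ χ) = postfix φ ++ postfix χ ++ or ∷ []

private
  build : List (Token V) → List (Formula V) → List (Formula V)
  build []           s           = s
  build (var v ∷ ts) s           = build ts (var v ∷ s)
  build (neg ∷ ts)   (φ ∷ s)     = build ts ((¬′ φ) ∷ s)
  build (and ∷ ts)   (χ ∷ φ ∷ s) = build ts ((φ ∧′ χ) ∷ s)
  build (or ∷ ts)    (χ ∷ φ ∷ s) = build ts ((φ ∨′ χ) ∷ s)
  build _            _           = []

  build-postfix : ∀ (φ : Formula V) ts s →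
                  build (postfix φ ++ ts) s ≡ build ts (φ ∷ s)
  build-binary : ∀ (φ χ : Formula V) t ts s →
                 build ((postfix φ ++ postfix χ ++ t ∷ []) ++ ts) s
                   ≡ build (t ∷ ts) (χ ∷ φ ∷ s)
  build-postfix (var v) ts s = refl
  build-postfix (¬′ φ)  ts s =
    trans (cong (λ us → build us s) (++-assoc (postfix φ) (neg ∷ []) ts))
          (build-postfix φ (neg ∷ ts) s)
  build-postfix (φ ∧′ χ) ts s = build-binary φ χ and ts s
  build-postfix (φ ∨′ χ) ts s = build-binary φ χ or ts s
  build-binary φ χ t ts s = begin
    build ((postfix φ ++ postfix χ ++ t ∷ []) ++ ts) s
      ≡⟨ cong (λ us → build us s) (++-assoc (postfix φ) _ ts) ⟩
    build (postfix φ ++ (postfix χ ++ t ∷ []) ++ ts) s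
      ≡⟨ build-postfix φ _ s ⟩
    build ((postfix χ ++ t ∷ []) ++ ts) (φ ∷ s)
      ≡⟨ cong (λ us → build us (φ ∷ s)) (++-assoc (postfix χ) _ ts) ⟩
    build (postfix χ ++ t ∷ ts) (φ ∷ s)
      ≡⟨ build-postfix χ _ (φ ∷ s) ⟩
    build (t ∷ ts) (χ ∷ φ ∷ s) ∎
    where open ≡-Reasoning

postfix-injective : Injective _≡_ _≡_ (postfix {V})
postfix-injective {x = φ} {y = χ} eq
  with refl ← trans (sym (build-postfix φ [] []))
                    (trans (cong (λ ts → build (ts ++ []) []) eq)
                           (build-postfix χ [] []))
  = refl

encodeToken : Token (Fin n ⊎ Fin n) → Word
encodeToken (var (inj₁ i)) = false ∷ false ∷ encodeFin i
encodeToken (var (inj₂ i)) = false ∷ true ∷ encodeFin i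
encodeToken neg            = true ∷ false ∷ []
encodeToken and            = true ∷ true ∷ false ∷ []
encodeToken or             = true ∷ true ∷ true ∷ []

encodeToken-prefixFree : PrefixFree (encodeToken {n})
encodeToken-prefixFree (var (inj₁ i)) (var (inj₁ j)) eq
  with refl , p ← encodeFin-prefixFree i j (∷-injectiveʳ (∷-injectiveʳ eq)) = refl , p
encodeToken-prefixFree (var (inj₂ i)) (var (inj₂ j)) eq
  with refl , p ← encodeFin-prefixFree i j (∷-injectiveʳ (∷-injectiveʳ eq)) = refl , p
encodeToken-prefixFree neg neg refl = refl , refl
encodeToken-prefixFree and and refl = refl , refl
encodeToken-prefixFree or  or  refl = refl , refl
encodeToken-prefixFree (var (inj₁ _)) (var (inj₂ _)) ()
encodeToken-prefixFree (var (inj₂ _)) (var (inj₁ _)) ()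
encodeToken-prefixFree (var (inj₁ _)) neg ()
encodeToken-prefixFree (var (inj₁ _)) and ()
encodeToken-prefixFree (var (inj₁ _)) or ()
encodeToken-prefixFree (var (inj₂ _)) neg ()
encodeToken-prefixFree (var (inj₂ _)) and ()
encodeToken-prefixFree (var (inj₂ _)) or ()
encodeToken-prefixFree neg (var (inj₁ _)) ()
encodeToken-prefixFree neg (var (inj₂ _)) ()
encodeToken-prefixFree and (var (inj₁ _)) ()
encodeToken-prefixFree and (var (inj₂ _)) ()
encodeToken-prefixFree or (var (inj₁ _)) ()
encodeToken-prefixFree or (var (inj₂ _)) ()

encodeTokens-injective : Injective _≡_ _≡_ (concatMap (encodeToken {n}))
encodeTokens-injective {x = []}     {y = []}     _  = refl
encodeTokens-injective {x = t ∷ ts} {y = u ∷ us} eq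
  with refl , p ← encodeToken-prefixFree t u eq = cong (t ∷_) (encodeTokens-injective p)
encodeTokens-injective {x = []} {y = var (inj₁ _) ∷ _} ()
encodeTokens-injective {x = []} {y = var (inj₂ _) ∷ _} ()
encodeTokens-injective {x = []} {y = neg ∷ _} ()
encodeTokens-injective {x = []} {y = and ∷ _} ()
encodeTokens-injective {x = []} {y = or ∷ _} ()
encodeTokens-injective {x = var (inj₁ _) ∷ _} {y = []} ()
encodeTokens-injective {x = var (inj₂ _) ∷ _} {y = []} ()
encodeTokens-injective {x = neg ∷ _} {y = []} ()
encodeTokens-injective {x = and ∷ _} {y = []} ()
encodeTokens-injective {x = or ∷ _} {y = []} ()

encodeFormula : Formula (Fin n ⊎ Fin n) → Word
encodeFormula φ = concatMap encodeToken (postfix φ)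

------------------------------------------------------------------------
-- Boolean circuits

-- Operands are indices of available wires.
data Gate (w : ℕ) : Set where
  NOT    : Fin w → Gate w
  AND OR : Fin w → Fin w → Gate w

-- `Circuit w o` is a circuit with w available wires and o outputs, its gates in
-- topological order: wires 0 … w-1 are available at the outset, and each gate
-- adds its value as wire w. In particular, Circuit m o computes a function
-- {0,1}^m → {0,1}^o. The output wires need not be distinct.
data Circuit (w o : ℕ) : Set where
  outputs : Vec (Fin w) o → Circuit w o
  gate    : Gate w → Circuit (suc w) o → Circuit w o

evalGate : Gate m → Vec Bool m → Bool
evalGate (NOT i)   v = not (lookup v i)
evalGate (AND i j) v = lookup v i ∧ lookup v j
evalGate (OR i j)  v = lookup v i ∨ lookup v j

evalCircuit : Circuit m n → Vec Bool m → Vec Bool n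
evalCircuit (outputs os) v = Vec.map (lookup v) os
evalCircuit (gate g C)   v = evalCircuit C (v ∷ʳ evalGate g v)

encodeGate : Gate m → Word
encodeGate (NOT i)   = false ∷ encodeFin i
encodeGate (AND i j) = true ∷ false ∷ encodeFin i ++ encodeFin j
encodeGate (OR i j)  = true ∷ true ∷ encodeFin i ++ encodeFin j

encodeOutputs : Vec (Fin m) n → Word
encodeOutputs []       = []
encodeOutputs (i ∷ is) = encodeFin i ++ encodeOutputs is

encodeCircuit : Circuit m n → Word
encodeCircuit (outputs os) = false ∷ encodeOutputs os
encodeCircuit (gate g C)   = true ∷ encodeGate g ++ encodeCircuit C

private
  encodeFins-prefixFree : ∀ (i j i′ j′ : Fin n) {u v} →
    (encodeFin i ++ encodeFin j) ++ u ≡ (encodeFin i′ ++ encodeFin j′) ++ v →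
    i ≡ i′ × j ≡ j′ × u ≡ v
  encodeFins-prefixFree i j i′ j′ eq
    with refl , p ← encodeFin-prefixFree i i′ (reassoc (encodeFin i) (encodeFin i′) eq)
    with refl , q ← encodeFin-prefixFree j j′ p = refl , refl , q

encodeGate-prefixFree : PrefixFree (encodeGate {m})
encodeGate-prefixFree (NOT i) (NOT j) eq
  with refl , p ← encodeFin-prefixFree i j (∷-injectiveʳ eq) = refl , p
encodeGate-prefixFree (AND i j) (AND i′ j′) eq
  with refl , refl , p ← encodeFins-prefixFree i j i′ j′ (∷-injectiveʳ (∷-injectiveʳ eq))
  = refl , p
encodeGate-prefixFree (OR i j) (OR i′ j′) eq
  with refl , refl , p ← encodeFins-prefixFree i j i′ j′ (∷-injectiveʳ (∷-injectiveʳ eq))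
  = refl , p

encodeOutputs-prefixFree : PrefixFree (encodeOutputs {m} {n})
encodeOutputs-prefixFree []       []       eq = refl , eq
encodeOutputs-prefixFree (i ∷ is) (j ∷ js) eq
  with refl , p ← encodeFin-prefixFree i j (reassoc (encodeFin i) (encodeFin j) eq)
  with refl , q ← encodeOutputs-prefixFree is js p = refl , q

encodeCircuit-prefixFree : PrefixFree (encodeCircuit {m} {n})
encodeCircuit-prefixFree (outputs is) (outputs js) eq
  with refl , p ← encodeOutputs-prefixFree is js (∷-injectiveʳ eq) = refl , p
encodeCircuit-prefixFree (gate g C) (gate h D) eq
  with refl , p ← encodeGate-prefixFree g h
                    (reassoc (encodeGate g) (encodeGate h) (∷-injectiveʳ eq))
  with refl , q ← encodeCircuit-prefixFree C D p = refl , q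

bit : Bool → ℕ
bit false = 0
bit true  = 1

-- Most significant bit first.
value : Vec Bool n → ℕ
value []               = 0
value {suc n} (b ∷ bs) = bit b * 2 ^ n + value bs

------------------------------------------------------------------------
-- The two problems

-- `var (inj₁ i)` is the i-th variable of X, `var (inj₂ i)` that of Y.
U∃∀-Sat : Problem
U∃∀-Sat = record
  { Instance         = Σ ℕ λ n → Formula (Fin n ⊎ Fin n)
  ; Yes              = λ (n , ψ) → ∃! _≡_ λ (x : Vec Bool n) →
                         ∀ (y′ : Vec Bool n) → eval [ lookup x , lookup y′ ] ψ ≡ true
  ; encode           = enc
  ; encode-injective = λ {i} {j} → inj i j
  }
  where
  enc : (Σ ℕ λ n → Formula (Fin n ⊎ Fin n)) → Word
  enc (n , ψ) = unary n ++ encodeFormula ψ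

  inj : ∀ i j → enc i ≡ enc j → i ≡ j
  inj (m , φ) (n , ψ) eq with refl , p ← unary-prefixFree m n eq =
    cong (m ,_) (postfix-injective (encodeTokens-injective p))

WDom-Strategy : Problem
WDom-Strategy = record
  { Instance         = Σ ℕ λ n → Circuit (n + n) n
  ; Yes              = λ (n , circuit) →
                         let C : Vec Bool n → Vec Bool n → ℕ
                             C x y = value (evalCircuit circuit (x Vec.++ y))
                         in ∃[ x ] ∀ x′ y → x′ ≢ x →
                              ∃[ y′ ] (C x y ≥ C x′ y × C x y′ > C x′ y′)
  ; encode           = enc
  ; encode-injective = λ {i} {j} → inj i j
  }
  where
  enc : (Σ ℕ λ n → Circuit (n + n) n) → Word
  enc (n , C) = unary n ++ encodeCircuit C

  inj : ∀ i j → enc i ≡ enc j → i ≡ j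
  inj (m , C) (n , D) eq with refl , p ← unary-prefixFree m n eq =
    cong (m ,_) (prefixFree⇒injective encodeCircuit-prefixFree p)

{-# OPTIONS --safe #-}

-- From formulas to games: a strategy is a bit b and an assignment x, and its
-- payoff is 2^n if b holds and ψ(x, y) is true, 0 if b holds and ψ(x, y) is
-- false, and 2^n - 1 if b fails. Strategies without b tie with each other, so
-- none of them is dominant, and (1, x) is dominant exactly if ψ(x, _) is valid
-- and no other x′ has this property.
--
-- From games to formulas: a weakly dominant strategy is the same as a unique x
-- with C(x‖y) ≥ C(x′‖y) for all x′ and y, because whatever beats x′ somewhere is
-- itself at most as good as x there. The universal variables hold x′, y and the
-- values of all gates of C(x‖y) and C(x′‖y); the formula says that some gate
-- value is wrong or the inequality holds.
--
-- Both translations are computed by structured programs over stacks of bits,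
-- which compile to Turing machines with one tape per stack.

module Submission where

open import Data.Bool using (Bool; true; false; not; _∧_; _∨_; if_then_else_; T)
import Data.Bool.Properties as Bool
open import Data.Empty using (⊥-elim)
open import Data.Fin using (Fin; zero; suc; toℕ; _↑ˡ_; _↑ʳ_)
open import Data.Fin.Properties
  using (1↔⊤; +↔⊎; toℕ-injective; toℕ-↑ˡ; toℕ-↑ʳ; toℕ≤pred[n]; toℕ<n)
open import Data.List as List using (List; []; _∷_; _++_; _ʳ++_; length; concatMap)
open import Data.List.Properties
  using (++-ʳ++; ʳ++-ʳ++; length-ʳ++; ++-assoc; ++-identityʳ; length-++; concatMap-++)
import Data.Maybe as Maybe
open import Data.Maybe using (Maybe; just; nothing; maybe′)
open import Data.Nat
open import Data.Nat.Properties
open import Data.Nat.Solver using (module +-*-Solver)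
open import Data.Product using (∃-syntax; _×_; _,_; proj₁; proj₂; map₁)
open import Data.Sum using (_⊎_; inj₁; inj₂; [_,_])
open import Data.Sum.Function.Propositional using (_⊎-↔_)
open import Data.Unit using (⊤; tt)
open import Data.Vec as Vec
  using (Vec; []; _∷_; lookup; updateAt; _[_]≔_; zipWith; _∷ʳ_; tabulate)
open import Data.Vec.Membership.Propositional.Properties using (∈-lookup)
open import Data.Vec.Properties
  using (lookup-map; []≔-lookup; lookup∘update; lookup-++ˡ; lookup-++ʳ; map-replicate; ≡-dec;
         lookup∘tabulate; tabulate∘lookup; tabulate-cong)
open import Data.Vec.Relation.Binary.Pointwise.Inductive using (Pointwise; []; _∷_)
open import Data.Vec.Relation.Unary.All as All using (All; []; _∷_)
open import Function using (_∘_; id; _↔_; _⇔_; mk⇔)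
open import Function.Construct.Composition using (_↔-∘_)
open import Function.Construct.Symmetry using (↔-sym)
open import Relation.Binary.PropositionalEquality
  using (_≡_; _≢_; refl; sym; trans; cong; cong₂; subst; subst₂; module ≡-Reasoning)
open import Relation.Nullary using (yes; no)

open import Defs

-- Two strategies that are each at least as good as every other tie against every y, so a weakly
-- dominant strategy is unique. Conversely, the strict improvement has to be exhibited, which is
-- done by exhaustive search.
--
-- The obstacle in the direction from games is that evaluating a circuit by a formula calls for
-- auxiliary variables, which one would quantify existentially, whereas only the universal block is
-- available. Hence wrong guesses of gate values are made to satisfy the formula. Since X must have
-- as many variables as Y, far more than a strategy has bits, the surplus of X is fixed to true to
-- keep x unique.
--
-- Both outputs are written front to back in one pass: gates follow the order of the tokens, and
-- formulas grow by appending to their postfix form. The number of variables is written before the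
-- circuit is read, so it is computed from the input length ℓ, which bounds the number of wires. The
-- second copy of wire w has index ℓ + w, so that writing it takes no addition.

private
  variable
    k m n t u : ℕ
    b : Bool

-- Structured programs over bit stacks

infixr 5 _⨾_

data Prog (k : ℕ) : Set where
  skip  : Prog k
  push  : Fin k → Bool → Prog k
  pop   : Fin k → Prog k
  _⨾_   : Prog k → Prog k → Prog k
  ifTop : Fin k → (Symbol → Bool) → Prog k → Prog k → Prog k
  while : Fin k → (Symbol → Bool) → Prog k → Prog k

Stacks : ℕ → Set
Stacks = Vec Word

top : Stacks k → Fin k → Symbol
top σ i = List.head (lookup σ i)

infix 4 _⊢_⇒_within_

-- The times are upper bounds on the steps of the compiled machine, hence `weaken`. A `pop` has a
-- derivation only for a nonempty stack, because the tape below the bottom of a stack is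
-- unspecified.
data _⊢_⇒_within_ {k} : Prog k → Stacks k → Stacks k → ℕ → Set where
  skip   : ∀ {σ} → skip ⊢ σ ⇒ σ within 1
  push   : ∀ {i b σ} → push i b ⊢ σ ⇒ updateAt σ i (b ∷_) within 2
  pop    : ∀ {i σ w} → lookup σ i ≡ b ∷ w → pop i ⊢ σ ⇒ σ [ i ]≔ w within 1
  _⨾_    : ∀ {p q σ τ ρ} → p ⊢ σ ⇒ τ within t → q ⊢ τ ⇒ ρ within u →
           p ⨾ q ⊢ σ ⇒ ρ within (t + u)
  then   : ∀ {i c p q σ τ} → c (top σ i) ≡ true → p ⊢ σ ⇒ τ within t →
           ifTop i c p q ⊢ σ ⇒ τ within suc t
  else   : ∀ {i c p q σ τ} → c (top σ i) ≡ false → q ⊢ σ ⇒ τ within t →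
           ifTop i c p q ⊢ σ ⇒ τ within suc t
  exit   : ∀ {i c p σ} → c (top σ i) ≡ false → while i c p ⊢ σ ⇒ σ within 1
  loop   : ∀ {i c p σ τ ρ} → c (top σ i) ≡ true →
           p ⊢ σ ⇒ τ within t → while i c p ⊢ τ ⇒ ρ within u →
           while i c p ⊢ σ ⇒ ρ within suc (t + u)
  weaken : ∀ {p σ τ} → t ≤ u → p ⊢ σ ⇒ τ within t → p ⊢ σ ⇒ τ within u

length-updateAt : ∀ (σ : Stacks k) i j b →
  length (lookup (updateAt σ i (b ∷_)) j) ≤ suc (length (lookup σ j))
length-updateAt (_ ∷ _) zero    zero    b = ≤-refl
length-updateAt (_ ∷ _) zero    (suc _) b = n≤1+n _
length-updateAt (_ ∷ _) (suc _) zero    b = n≤1+n _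
length-updateAt (_ ∷ σ) (suc i) (suc j) b = length-updateAt σ i j b

length-[]≔ : ∀ (σ : Stacks k) i j {b w} → lookup σ i ≡ b ∷ w →
  length (lookup (σ [ i ]≔ w) j) ≤ length (lookup σ j)
length-[]≔ (_ ∷ _) zero    zero    refl = n≤1+n _
length-[]≔ (_ ∷ _) zero    (suc _) _    = ≤-refl
length-[]≔ (_ ∷ _) (suc _) zero    _    = ≤-refl
length-[]≔ (_ ∷ σ) (suc i) (suc j) eq   = length-[]≔ σ i j eq

+-chain : ∀ t u {l m n} → m ≤ t + l → n ≤ u + m → n ≤ t + u + l
+-chain t u {l} {m} {n} m≤ n≤ = begin
  n           ≤⟨ n≤ ⟩
  u + m       ≤⟨ +-monoʳ-≤ u m≤ ⟩
  u + (t + l) ≡⟨ +-assoc u t l ⟨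
  u + t + l   ≡⟨ cong (_+ l) (+-comm u t) ⟩
  t + u + l   ∎
  where open ≤-Reasoning

-- A step adds at most one bit to a stack. Applied to `out`, this bounds the output length by the
-- running time, and with it the time for moving the output to the first tape.
height-grows : ∀ {p : Prog k} {σ τ} j → p ⊢ σ ⇒ τ within t →
  length (lookup τ j) ≤ t + length (lookup σ j)
height-grows j skip = n≤1+n _
height-grows j (push {i} {b} {σ}) = m≤n⇒m≤1+n (length-updateAt σ i j b)
height-grows j (pop {i = i} {σ} eq) = m≤n⇒m≤1+n (length-[]≔ σ i j eq)
height-grows j (_⨾_ {t} {u} r s) = +-chain t u (height-grows j r) (height-grows j s)
height-grows j (then _ r) = m≤n⇒m≤1+n (height-grows j r)
height-grows j (else _ r) = m≤n⇒m≤1+n (height-grows j r)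
height-grows j (exit _) = n≤1+n _
height-grows j (loop {t = t} {u} _ r s) =
  m≤n⇒m≤1+n (+-chain t u (height-grows j r) (height-grows j s))
height-grows {σ = σ} j (weaken le r) =
  ≤-trans (height-grows j r) (+-monoˡ-≤ (length (lookup σ j)) le)

-- Compilation to Turing machines

-- Pushing takes two steps, so it has two control states.
Control : Prog k → Set
Control skip            = ⊤
Control (push _ _)      = ⊤ ⊎ ⊤
Control (pop _)         = ⊤
Control (p ⨾ q)         = Control p ⊎ Control q
Control (ifTop _ _ p q) = ⊤ ⊎ (Control p ⊎ Control q)
Control (while _ _ p)   = ⊤ ⊎ Control p

entry : (p : Prog k) → Control p
entry skip            = tt
entry (push _ _)      = inj₁ tt
entry (pop _)         = tt
entry (p ⨾ q)         = inj₁ (entry p)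
entry (ifTop _ _ _ _) = inj₁ tt
entry (while _ _ _)   = inj₁ tt

finite-⊎ : ∀ {A B : Set} → ∃[ m ] (A ↔ Fin m) → ∃[ n ] (B ↔ Fin n) →
           ∃[ q ] ((A ⊎ B) ↔ Fin q)
finite-⊎ (m , f) (n , g) = m + n , ↔-sym +↔⊎ ↔-∘ (f ⊎-↔ g)

finite-⊤ : ∃[ q ] (⊤ ↔ Fin q)
finite-⊤ = 1 , ↔-sym 1↔⊤

control-finite : (p : Prog k) → ∃[ q ] (Control p ↔ Fin q)
control-finite skip            = finite-⊤
control-finite (push _ _)      = finite-⊎ finite-⊤ finite-⊤
control-finite (pop _)         = finite-⊤
control-finite (p ⨾ q)         = finite-⊎ (control-finite p) (control-finite q)
control-finite (ifTop _ _ p q) = finite-⊎ finite-⊤ (finite-⊎ (control-finite p) (control-finite q))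
control-finite (while _ _ p)   = finite-⊎ finite-⊤ (control-finite p)

Actions : ℕ → Set
Actions = Vec (Symbol × Move)

idle : Vec Symbol k → Actions k
idle = Vec.map (_, stay)

-- `nothing` leaves the program.
next : (p : Prog k) → Control p → Vec Symbol k → Maybe (Control p) × Actions k
next skip _ as = nothing , idle as
-- An action writes before it moves: the first step restores the old top and moves off it, only the
-- second can write the new one.
next (push i b) (inj₁ _) as = just (inj₂ tt) , idle as [ i ]≔ (lookup as i , left)
next (push i b) (inj₂ _) as = nothing , idle as [ i ]≔ (just b , stay)
next (pop i) _ as = nothing , idle as [ i ]≔ (nothing , right)
-- The last step of `p` already leads to the entry of `q`, so that sequencing costs nothing.
next (p ⨾ q) (inj₁ s) as = map₁ (λ x → just (maybe′ inj₁ (inj₂ (entry q)) x)) (next p s as)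
next (p ⨾ q) (inj₂ s) as = map₁ (Maybe.map inj₂) (next q s as)
next (ifTop i c p q) (inj₁ _) as =
  just (inj₂ (if c (lookup as i) then inj₁ (entry p) else inj₂ (entry q))) , idle as
next (ifTop i c p q) (inj₂ (inj₁ s)) as = map₁ (Maybe.map λ x → inj₂ (inj₁ x)) (next p s as)
next (ifTop i c p q) (inj₂ (inj₂ s)) as = map₁ (Maybe.map λ x → inj₂ (inj₂ x)) (next q s as)
next (while i c p) (inj₁ _) as =
  (if c (lookup as i) then just (inj₂ (entry p)) else nothing) , idle as
next (while i c p) (inj₂ s) as = map₁ (λ x → just (maybe′ inj₂ (inj₁ tt) x)) (next p s as)

-- Runs that end by leaving `p`, with no mention of a halting state, so that they can be embedded
-- into runs of any program containing `p`.
data Exec (p : Prog k) : Control p → Vec Tape k → ℕ → Vec Tape k → Set where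
  leave : ∀ {s ts as} → next p s (Vec.map head ts) ≡ (nothing , as) →
          Exec p s ts 1 (zipWith act as ts)
  goto  : ∀ {s s′ ts ts′ as t} → next p s (Vec.map head ts) ≡ (just s′ , as) →
          Exec p s′ (zipWith act as ts) t ts′ → Exec p s ts (suc t) ts′

exec-⨾₂ : ∀ {p q : Prog k} {s ts ts′} → Exec q s ts t ts′ → Exec (p ⨾ q) (inj₂ s) ts t ts′
exec-⨾₂ (leave eq)  = leave (cong (map₁ (Maybe.map inj₂)) eq)
exec-⨾₂ (goto eq e) = goto (cong (map₁ (Maybe.map inj₂)) eq) (exec-⨾₂ e)

exec-⨾ : ∀ {p q : Prog k} {s ts ts′ ts″} → Exec p s ts t ts′ → Exec q (entry q) ts′ u ts″ →
         Exec (p ⨾ q) (inj₁ s) ts (t + u) ts″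
exec-⨾ {q = q} (leave eq)  f =
  goto (cong (map₁ (λ x → just (maybe′ inj₁ (inj₂ (entry q)) x))) eq) (exec-⨾₂ f)
exec-⨾ {q = q} (goto eq e) f =
  goto (cong (map₁ (λ x → just (maybe′ inj₁ (inj₂ (entry q)) x))) eq) (exec-⨾ e f)

exec-then : ∀ {i c} {p q : Prog k} {s ts ts′} → Exec p s ts t ts′ →
            Exec (ifTop i c p q) (inj₂ (inj₁ s)) ts t ts′
exec-then (leave eq)  = leave (cong (map₁ (Maybe.map _)) eq)
exec-then (goto eq e) = goto (cong (map₁ (Maybe.map _)) eq) (exec-then e)

exec-else : ∀ {i c} {p q : Prog k} {s ts ts′} → Exec q s ts t ts′ →
            Exec (ifTop i c p q) (inj₂ (inj₂ s)) ts t ts′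
exec-else (leave eq)  = leave (cong (map₁ (Maybe.map _)) eq)
exec-else (goto eq e) = goto (cong (map₁ (Maybe.map _)) eq) (exec-else e)

exec-loop : ∀ {i c} {p : Prog k} {s ts ts′ ts″} → Exec p s ts t ts′ →
            Exec (while i c p) (inj₁ tt) ts′ u ts″ → Exec (while i c p) (inj₂ s) ts (t + u) ts″
exec-loop (leave eq)  f = goto (cong (map₁ λ x → just (maybe′ inj₂ (inj₁ tt) x)) eq) f
exec-loop (goto eq e) f =
  goto (cong (map₁ λ x → just (maybe′ inj₂ (inj₁ tt) x)) eq) (exec-loop e f)

-- The symbols from the top of the stack on; a blank marks the bottom, and below
-- it the tape may hold anything.
data Content : Word → List Symbol → Set where
  end   : Content [] []
  blank : ∀ {as} → Content [] (nothing ∷ as)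
  _∷_   : ∀ b {w as} → Content w as → Content (b ∷ w) (just b ∷ as)

Holds : Word → Tape → Set
Holds w t = Content w (head t ∷ rights t)

Represents : Stacks k → Vec Tape k → Set
Represents = Pointwise Holds

holds-head : ∀ {w} t → Holds w t → head t ≡ List.head w
holds-head _ blank   = refl
holds-head _ (_ ∷ _) = refl

represents-top : ∀ {σ : Stacks k} {ts} i → Represents σ ts → lookup (Vec.map head ts) i ≡ top σ i
represents-top {ts = t ∷ _} zero    (h ∷ _) = holds-head t h
represents-top {ts = _ ∷ _} (suc i) (_ ∷ r) = represents-top i r

holds-push : ∀ b {w} t → Holds w t →
             Holds (b ∷ w) (act (just b , stay) (act (head t , left) t))
holds-push b (tape []      _ _) h = b ∷ h
holds-push b (tape (_ ∷ _) _ _) h = b ∷ h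

holds-pop : ∀ {b w} t → Holds (b ∷ w) t → Holds w (act (nothing , right) t)
holds-pop (tape _ _ [])      (_ ∷ end) = blank
holds-pop (tape _ _ (_ ∷ _)) (_ ∷ h)   = h

represents-push : ∀ {σ : Stacks k} {ts} i b → Represents σ ts →
  Represents (updateAt σ i (b ∷_))
    (updateAt (updateAt ts i (act (lookup (Vec.map head ts) i , left))) i (act (just b , stay)))
represents-push {ts = t ∷ _} zero    b (h ∷ r) = holds-push b t h ∷ r
represents-push {ts = _ ∷ _} (suc i) b (h ∷ r) = h ∷ represents-push i b r

represents-pop : ∀ {σ : Stacks k} {ts} i {b w} → Represents σ ts → lookup σ i ≡ b ∷ w →
                 Represents (σ [ i ]≔ w) (updateAt ts i (act (nothing , right)))
represents-pop {ts = t ∷ _} zero    (h ∷ r) refl = holds-pop t h ∷ r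
represents-pop {ts = _ ∷ _} (suc i) (h ∷ r) eq   = h ∷ represents-pop i r eq

act-idle : (ts : Vec Tape k) → zipWith act (idle (Vec.map head ts)) ts ≡ ts
act-idle []       = refl
act-idle (t ∷ ts) = cong (t ∷_) (act-idle ts)

act-at : ∀ (ts : Vec Tape k) i a →
  zipWith act (idle (Vec.map head ts) [ i ]≔ a) ts ≡ updateAt ts i (act a)
act-at (t ∷ ts) zero    a = cong (act a t ∷_) (act-idle ts)
act-at (t ∷ ts) (suc i) a = cong (t ∷_) (act-at ts i a)

leave-at : ∀ {p : Prog k} {s ts i a} →
  next p s (Vec.map head ts) ≡ (nothing , idle (Vec.map head ts) [ i ]≔ a) →
  Exec p s ts 1 (updateAt ts i (act a))
leave-at {ts = ts} {i} {a} eq = subst (Exec _ _ _ _) (act-at ts i a) (leave eq)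

goto-at : ∀ {p : Prog k} {s s′ ts ts′ i a} →
  next p s (Vec.map head ts) ≡ (just s′ , idle (Vec.map head ts) [ i ]≔ a) →
  Exec p s′ (updateAt ts i (act a)) t ts′ → Exec p s ts (suc t) ts′
goto-at {ts = ts} {i = i} {a} eq e =
  goto eq (subst (λ us → Exec _ _ us _ _) (sym (act-at ts i a)) e)

leave-idle : ∀ {p : Prog k} {s ts} →
  next p s (Vec.map head ts) ≡ (nothing , idle (Vec.map head ts)) → Exec p s ts 1 ts
leave-idle {ts = ts} eq = subst (Exec _ _ _ _) (act-idle ts) (leave eq)

goto-idle : ∀ {p : Prog k} {s s′ ts ts′} →
  next p s (Vec.map head ts) ≡ (just s′ , idle (Vec.map head ts)) →
  Exec p s′ ts t ts′ → Exec p s ts (suc t) ts′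
goto-idle {ts = ts} eq e = goto eq (subst (λ us → Exec _ _ us _ _) (sym (act-idle ts)) e)

branch : ∀ {σ : Stacks k} {ts} i c → Represents σ ts → c (top σ i) ≡ b →
         c (lookup (Vec.map head ts) i) ≡ b
branch i c rep eq = trans (cong c (represents-top i rep)) eq

-- Induction on the derivation and not on the program, since the derivation of a loop contains its
-- iterations.
simulate : ∀ {p : Prog k} {σ τ ts} → p ⊢ σ ⇒ τ within t → Represents σ ts →
  ∃[ t′ ] ∃[ ts′ ] t′ ≤ t × Represents τ ts′ × Exec p (entry p) ts t′ ts′
simulate skip rep = 1 , _ , ≤-refl , rep , leave-idle refl
simulate (push {i} {b}) rep =
  2 , _ , ≤-refl , represents-push i b rep , goto-at refl (leave-at refl)
simulate (pop {i = i} eq) rep = 1 , _ , ≤-refl , represents-pop i rep eq , leave-at refl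
simulate (r ⨾ s) rep =
  let t₁ , _ , le₁ , rep₁ , e₁ = simulate r rep
      t₂ , _ , le₂ , rep₂ , e₂ = simulate s rep₁
  in t₁ + t₂ , _ , +-mono-≤ le₁ le₂ , rep₂ , exec-⨾ e₁ e₂
simulate (then {i = i} {c} {p} {q} eq r) rep =
  let t₁ , _ , le₁ , rep₁ , e₁ = simulate r rep
  in suc t₁ , _ , s≤s le₁ , rep₁ ,
     goto-idle (cong (λ x → just (inj₂ (if x then inj₁ (entry p) else inj₂ (entry q))) , _)
                     (branch i c rep eq)) (exec-then e₁)
simulate (else {i = i} {c} {p} {q} eq r) rep =
  let t₁ , _ , le₁ , rep₁ , e₁ = simulate r rep
  in suc t₁ , _ , s≤s le₁ , rep₁ ,
     goto-idle (cong (λ x → just (inj₂ (if x then inj₁ (entry p) else inj₂ (entry q))) , _)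
                     (branch i c rep eq)) (exec-else e₁)
simulate (exit {i} {c} {p} eq) rep =
  1 , _ , ≤-refl , rep ,
  leave-idle (cong (λ x → (if x then just (inj₂ (entry p)) else nothing) , _) (branch i c rep eq))
simulate (loop {i = i} {c} {p} eq r s) rep =
  let t₁ , _ , le₁ , rep₁ , e₁ = simulate r rep
      t₂ , _ , le₂ , rep₂ , e₂ = simulate s rep₁
  in suc (t₁ + t₂) , _ , s≤s (+-mono-≤ le₁ le₂) , rep₂ ,
     goto-idle (cong (λ x → (if x then just (inj₂ (entry p)) else nothing) , _) (branch i c rep eq))
               (exec-loop e₁ e₂)
simulate (weaken le r) rep =
  let t₁ , _ , le₁ , rep₁ , e₁ = simulate r rep
  in t₁ , _ , ≤-trans le₁ le , rep₁ , e₁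

machine : ∀ {e} → Prog (suc e) → TM
machine {e} p = record
  { extraTapes = e
  ; State      = ⊤ ⊎ Control p
  ; finite     = finite-⊎ finite-⊤ (control-finite p)
  ; start      = inj₂ (entry p)
  ; δ          = λ { (inj₁ _) _  → nothing
                   ; (inj₂ s) as → just (map₁ (maybe′ inj₂ (inj₁ tt)) (next p s as)) }
  }

run-exec : ∀ {e} {p : Prog (suc e)} {s ts ts′} → Exec p s ts t ts′ →
           TM.run (machine p) t (inj₂ s , ts) ≡ (inj₁ tt , ts′)
run-exec (leave eq)  rewrite eq = refl
run-exec (goto eq e) rewrite eq = run-exec e

content-map : ∀ w → Content w (List.map just w)
content-map []      = end
content-map (b ∷ w) = b ∷ content-map w

holds-load : ∀ w → Holds w (load w)
holds-load []      = blank
holds-load (b ∷ w) = b ∷ content-map w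

holds-blank : ∀ n → Represents (Vec.replicate n []) (Vec.replicate n blankTape)
holds-blank zero    = []
holds-blank (suc n) = blank ∷ holds-blank n

content-bits : ∀ {w as} → Content w as → leadingBits as ≡ w
content-bits end     = refl
content-bits blank   = refl
content-bits (b ∷ c) = cong (b ∷_) (content-bits c)

computes : ∀ {e} {p : Prog (suc e)} {u v σ} → p ⊢ u ∷ Vec.replicate e [] ⇒ v ∷ σ within t →
           ∃[ t′ ] t′ ≤ t × Computes machine p ↦ u within v t′
computes {e = e} {p} {u} r with simulate r (holds-load u ∷ holds-blank e)
... | t′ , _ ∷ _ , le , h ∷ _ , ex =
  t′ , le , cong (TM.step (machine p)) halted ,
  trans (cong (λ c → readOut (lookup (proj₂ c) zero)) halted) (content-bits h)
  where halted = run-exec ex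

-- Loops, unary registers and reversed output

isTrue : Symbol → Bool
isTrue (just b) = b
isTrue nothing  = false

nonEmpty : Symbol → Bool
nonEmpty = Maybe.is-just

-- The loop invariant is a function of the iterations to come, `w`, and those done, `d`. The
-- equation `suc w + d ≡ N` handed to the step is what bounds registers inside the loop.
countdown : ∀ {i : Fin k} {p} N (σ : ℕ → ℕ → Stacks k) →
  (∀ w d → isTrue (top (σ (suc w) d) i) ≡ true) →
  (∀ d → isTrue (top (σ zero d) i) ≡ false) →
  (∀ w d → suc w + d ≡ N → p ⊢ σ (suc w) d ⇒ σ w (suc d) within t) →
  while i isTrue p ⊢ σ N 0 ⇒ σ 0 N within N * suc t + 1
countdown {t = t} {i} {p} N σ more done step = go N 0 (+-identityʳ N)
  where
  go : ∀ w d → w + d ≡ N → while i isTrue p ⊢ σ w d ⇒ σ 0 N within w * suc t + 1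
  go zero    d refl = exit (done d)
  go (suc w) d eq   = weaken (≤-reflexive (cong suc (sym (+-assoc t (w * suc t) 1))))
    (loop (more w d) (step w d eq) (go w (suc d) (trans (+-suc w d) eq)))

drain : ∀ {i : Fin k} {p} (σ : Word → Word → Stacks k) →
  (∀ b w d → nonEmpty (top (σ (b ∷ w) d) i) ≡ true) →
  (∀ d → nonEmpty (top (σ [] d) i) ≡ false) →
  (∀ b w d → p ⊢ σ (b ∷ w) d ⇒ σ w (b ∷ d) within t) →
  ∀ w d → while i nonEmpty p ⊢ σ w d ⇒ σ [] (w ʳ++ d) within length w * suc t + 1
drain σ more done step []      d = exit (done d)
drain {t = t} σ more done step (b ∷ w) d =
  weaken (≤-reflexive (cong suc (sym (+-assoc t (length w * suc t) 1))))
    (loop (more b w d) (step b w d) (drain σ more done step w (b ∷ d)))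

remaining≤ : ∀ {w d N} → suc w + d ≡ N → w ≤ N
remaining≤ {w} {d} refl = m≤n⇒m≤1+n (m≤m+n w d)

elapsed≤ : ∀ {w d N} → suc w + d ≡ N → d ≤ N
elapsed≤ {w} {d} refl = m≤n+m d (suc w)

start-≡ : ∀ {p : Prog k} {σ σ′ τ} → σ ≡ σ′ → p ⊢ σ′ ⇒ τ within t → p ⊢ σ ⇒ τ within t
start-≡ refl r = r

finish-≡ : ∀ {p : Prog k} {σ τ τ′} → τ ≡ τ′ → p ⊢ σ ⇒ τ within t → p ⊢ σ ⇒ τ′ within t
finish-≡ refl r = r

shift : Fin k → Fin k → Prog k
shift i j = ifTop i isTrue (pop i ⨾ push j true) (pop i ⨾ push j false)

ones : ℕ → Word
ones n = List.replicate n true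

ones-snoc : ∀ n w → ones n ++ true ∷ w ≡ true ∷ ones n ++ w
ones-snoc zero    w = refl
ones-snoc (suc n) w = cong (true ∷_) (ones-snoc n w)

-- The input, the output in reverse, a scratch stack that is empty between
-- routines, an auxiliary stack, and registers holding numbers in unary.
⟨_,_,_∣_⟩ : Word → Word → Word → Vec ℕ m → Stacks (4 + m)
⟨ i , o , s ∣ rs ⟩ = i ∷ o ∷ [] ∷ s ∷ Vec.map ones rs

pattern inp   = zero
pattern out   = suc zero
pattern tmp   = suc (suc zero)
pattern aux   = suc (suc (suc zero))
pattern reg r = suc (suc (suc (suc r)))

push-reg : ∀ {i o x s} (rs : Vec ℕ m) r n →
  push (reg r) true ⊢ i ∷ o ∷ x ∷ s ∷ Vec.map ones (rs [ r ]≔ n)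
                    ⇒ i ∷ o ∷ x ∷ s ∷ Vec.map ones (rs [ r ]≔ suc n) within 2
push-reg {i = i} {o} {x} {s} rs r n =
  finish-≡ (cong (λ ss → i ∷ o ∷ x ∷ s ∷ ss) (grow rs r)) push
  where
  grow : ∀ {m} (rs : Vec ℕ m) r →
    updateAt (Vec.map ones (rs [ r ]≔ n)) r (true ∷_) ≡ Vec.map ones (rs [ r ]≔ suc n)
  grow (_ ∷ _)  zero    = refl
  grow (_ ∷ rs) (suc r) = cong (_ ∷_) (grow rs r)

pop-reg : ∀ {i o x s} (rs : Vec ℕ m) r n →
  pop (reg r) ⊢ i ∷ o ∷ x ∷ s ∷ Vec.map ones (rs [ r ]≔ suc n)
              ⇒ i ∷ o ∷ x ∷ s ∷ Vec.map ones (rs [ r ]≔ n) within 1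
pop-reg {i = i} {o} {x} {s} rs r n =
  finish-≡ (cong (λ ss → i ∷ o ∷ x ∷ s ∷ ss) (shrink rs r)) (pop (at rs r))
  where
  at : ∀ {m} (rs : Vec ℕ m) r → lookup (Vec.map ones (rs [ r ]≔ suc n)) r ≡ true ∷ ones n
  at (_ ∷ _)  zero    = refl
  at (_ ∷ rs) (suc r) = at rs r
  shrink : ∀ {m} (rs : Vec ℕ m) r →
    Vec.map ones (rs [ r ]≔ suc n) [ r ]≔ ones n ≡ Vec.map ones (rs [ r ]≔ n)
  shrink (_ ∷ _)  zero    = refl
  shrink (_ ∷ rs) (suc r) = cong (_ ∷_) (shrink rs r)

lookup-ones : ∀ (rs : Vec ℕ m) r n → lookup (Vec.map ones (rs [ r ]≔ n)) r ≡ ones n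
lookup-ones rs r n = trans (lookup-map r ones (rs [ r ]≔ n)) (cong ones (lookup∘update r rs n))

reg-true : ∀ (rs : Vec ℕ m) r n → isTrue (top (Vec.map ones (rs [ r ]≔ suc n)) r) ≡ true
reg-true rs r n rewrite lookup-ones rs r (suc n) = refl

reg-false : ∀ (rs : Vec ℕ m) r → isTrue (top (Vec.map ones (rs [ r ]≔ 0)) r) ≡ false
reg-false rs r rewrite lookup-ones rs r 0 = refl

-- Reading a stack destroys it, so `emitReg` makes a second copy on `tmp` and restores the register
-- from there.
emitReg clear readReg : Fin m → Prog (4 + m)
emitReg r = while (reg r) isTrue (pop (reg r) ⨾ push tmp true ⨾ push out true) ⨾
            while tmp isTrue (pop tmp ⨾ push (reg r) true)
clear r   = while (reg r) isTrue (pop (reg r))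
readReg r = while inp isTrue (pop inp ⨾ push (reg r) true) ⨾ pop inp

emitReg-run : ∀ {i o s} (rs : Vec ℕ m) r → let n = lookup rs r in
  emitReg r ⊢ ⟨ i , o , s ∣ rs ⟩ ⇒ ⟨ i , ones n ++ o , s ∣ rs ⟩ within n * 6 + 1 + (n * 4 + 1)
emitReg-run {i = i} {o} {s} rs r =
  start-≡ regs (finish-≡ (cong (λ rs′ → ⟨ i , ones c ++ o , s ∣ rs′ ⟩) ([]≔-lookup rs r))
    (countdown c (λ w d → i ∷ (ones d ++ o) ∷ ones d ∷ s ∷ Vec.map ones (rs [ r ]≔ w))
       (λ w _ → reg-true rs r w) (λ _ → reg-false rs r) (λ w _ _ → pop-reg rs r w ⨾ push ⨾ push) ⨾
     countdown c (λ w d → i ∷ (ones c ++ o) ∷ ones w ∷ s ∷ Vec.map ones (rs [ r ]≔ d))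
       (λ _ _ → refl) (λ _ → refl) (λ _ d _ → pop refl ⨾ push-reg rs r d)))
  where
  c = lookup rs r
  regs = cong (λ rs′ → ⟨ i , o , s ∣ rs′ ⟩) (sym ([]≔-lookup rs r))

clear-run : ∀ {i o s} (rs : Vec ℕ m) r →
  clear r ⊢ ⟨ i , o , s ∣ rs ⟩ ⇒ ⟨ i , o , s ∣ rs [ r ]≔ 0 ⟩ within lookup rs r * 2 + 1
clear-run {i = i} {o} {s} rs r =
  start-≡ (cong (λ rs′ → ⟨ i , o , s ∣ rs′ ⟩) (sym ([]≔-lookup rs r)))
    (countdown (lookup rs r) (λ w _ → ⟨ i , o , s ∣ rs [ r ]≔ w ⟩)
       (λ w _ → reg-true rs r w) (λ _ → reg-false rs r) (λ w _ _ → pop-reg rs r w))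

readReg-run : ∀ {i o s} (rs : Vec ℕ m) r n → lookup rs r ≡ 0 →
  readReg r ⊢ ⟨ unary n ++ i , o , s ∣ rs ⟩ ⇒ ⟨ i , o , s ∣ rs [ r ]≔ n ⟩ within n * 4 + 1 + 1
readReg-run {i = i} {o} {s} rs r n eq =
  start-≡ (cong (λ rs′ → ⟨ unary n ++ i , o , s ∣ rs′ ⟩)
                (sym (trans (cong (rs [ r ]≔_) (sym eq)) ([]≔-lookup rs r))))
    (countdown n (λ w d → ⟨ unary w ++ i , o , s ∣ rs [ r ]≔ d ⟩)
       (λ _ _ → refl) (λ _ → refl) (λ _ d _ → pop refl ⨾ push-reg rs r d) ⨾
     pop refl)

unary-ʳ++ : ∀ n w → unary n ʳ++ w ≡ false ∷ ones n ++ w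
unary-ʳ++ zero    w = refl
unary-ʳ++ (suc n) w = trans (unary-ʳ++ n (true ∷ w)) (cong (false ∷_) (ones-snoc n w))

-- The reason why a sum of registers can be emitted without being computed: their ones are written
-- one after the other and closed by a single `false`.
unary-+-ʳ++ : ∀ x y w → unary y ʳ++ (ones x ++ w) ≡ unary (x + y) ʳ++ w
unary-+-ʳ++ zero    y w = refl
unary-+-ʳ++ (suc x) y w =
  trans (cong (unary y ʳ++_) (sym (ones-snoc x w))) (unary-+-ʳ++ x y (true ∷ w))

-- Sums occur as `suc n + suc j`, the wires of the other player's bits, in one reduction and as
-- `ℓ + w`, the second copy of a wire, in the other.
data Index (m : ℕ) : Set where
  one : Fin m → Index m
  _⊕_ : Fin m → Fin m → Index m

index : Vec ℕ m → Index m → ℕ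
index rs (one r) = lookup rs r
index rs (q ⊕ r) = lookup rs q + lookup rs r

data Item (m : ℕ) : Set where
  lit : Bool → Item m
  num : Index m → Item m

emitted : Vec ℕ m → List (Item m) → Word → Word
emitted rs []           o = o
emitted rs (lit b ∷ xs) o = emitted rs xs (b ∷ o)
emitted rs (num ι ∷ xs) o = emitted rs xs (unary (index rs ι) ʳ++ o)

emit : List (Item m) → Prog (4 + m)
emit []                 = skip
emit (lit b ∷ xs)       = push out b ⨾ emit xs
emit (num (one r) ∷ xs)   = emitReg r ⨾ push out false ⨾ emit xs
emit (num (q ⊕ r) ∷ xs) = emitReg q ⨾ emitReg r ⨾ push out false ⨾ emit xs

emitCost : List (Item m) → ℕ
emitCost []                 = 1
emitCost (lit _ ∷ xs)       = 1 + emitCost xs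
emitCost (num (one _) ∷ xs)   = 2 + emitCost xs
emitCost (num (_ ⊕ _) ∷ xs) = 3 + emitCost xs

-- Time in units of a multiple of K + 1, so that handling a register of content
-- at most K takes a single unit.
module Units (K : ℕ) where

  -- The 10 comes from the most expensive routine that counts as one unit: emitting a register takes
  -- 10 steps for each of its ones, and 2 more.
  unit : ℕ
  unit = 10 * suc K

  infix 4 _⊢_⇒_#_

  -- A record, so that unification can recover `c`, which it could not from the product `c * unit`.
  record _⊢_⇒_#_ {k} (p : Prog k) (σ τ : Stacks k) (c : ℕ) : Set where
    constructor units
    field steps : p ⊢ σ ⇒ τ within c * unit

  open _⊢_⇒_#_ public

  Bounded : Vec ℕ m → Set
  Bounded = All (_≤ K)

  one-unit : ∀ {p : Prog k} {σ τ} a b → {a≤ : T (a ≤ᵇ 10)} → {b≤ : T (b ≤ᵇ 10)} → ∀ {n} → n ≤ K →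
             p ⊢ σ ⇒ τ within n * a + b → p ⊢ σ ⇒ τ # 1
  one-unit a b {a≤} {b≤} {n} n≤K r = units (weaken bound r)
    where
    open ≤-Reasoning
    bound : n * a + b ≤ 1 * unit
    bound = begin
      n * a + b    ≤⟨ +-mono-≤ (*-mono-≤ n≤K (≤ᵇ⇒≤ a 10 a≤)) (≤ᵇ⇒≤ b 10 b≤) ⟩
      K * 10 + 10  ≡⟨ +-comm (K * 10) 10 ⟩
      suc K * 10   ≡⟨ *-comm (suc K) 10 ⟩
      unit         ≡⟨ *-identityˡ unit ⟨
      1 * unit     ∎

  primitive# : ∀ {p : Prog k} {σ τ} b → {b≤ : T (b ≤ᵇ 10)} → p ⊢ σ ⇒ τ within b → p ⊢ σ ⇒ τ # 1
  primitive# b {b≤} r = one-unit 0 b {b≤ = b≤} (z≤n {K}) r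

  weaken# : ∀ {p : Prog k} {σ τ c d} → c ≤ d → p ⊢ σ ⇒ τ # c → p ⊢ σ ⇒ τ # d
  weaken# c≤d r = units (weaken (*-monoˡ-≤ unit c≤d) (steps r))

  start# : ∀ {p : Prog k} {σ σ′ τ c} → σ ≡ σ′ → p ⊢ σ′ ⇒ τ # c → p ⊢ σ ⇒ τ # c
  start# refl r = r

  finish# : ∀ {p : Prog k} {σ τ τ′ c} → τ ≡ τ′ → p ⊢ σ ⇒ τ # c → p ⊢ σ ⇒ τ′ # c
  finish# refl r = r

  infixr 5 _⨾#_

  _⨾#_ : ∀ {p q : Prog k} {σ τ ρ c d} → p ⊢ σ ⇒ τ # c → q ⊢ τ ⇒ ρ # d → p ⨾ q ⊢ σ ⇒ ρ # c + d
  _⨾#_ {c = c} {d} r s =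
    units (weaken (≤-reflexive (sym (*-distribʳ-+ unit c d))) (steps r ⨾ steps s))

  push# : ∀ {i : Fin k} {σ} → push i b ⊢ σ ⇒ updateAt σ i (b ∷_) # 1
  push# = primitive# 2 push

  pop# : ∀ {i : Fin k} {σ w} → lookup σ i ≡ b ∷ w → pop i ⊢ σ ⇒ σ [ i ]≔ w # 1
  pop# eq = primitive# 1 (pop eq)

  then# : ∀ {i c} {p q : Prog k} {σ τ d} → c (top σ i) ≡ true → p ⊢ σ ⇒ τ # d →
          ifTop i c p q ⊢ σ ⇒ τ # suc d
  then# {d = d} eq r = units (weaken (+-monoˡ-≤ (d * unit) (s≤s z≤n)) (then eq (steps r)))

  else# : ∀ {i c} {p q : Prog k} {σ τ d} → c (top σ i) ≡ false → q ⊢ σ ⇒ τ # d →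
          ifTop i c p q ⊢ σ ⇒ τ # suc d
  else# {d = d} eq r = units (weaken (+-monoˡ-≤ (d * unit) (s≤s z≤n)) (else eq (steps r)))

  exit# : ∀ {i c} {p : Prog k} {σ} → c (top σ i) ≡ false → while i c p ⊢ σ ⇒ σ # 1
  exit# eq = primitive# 1 (exit eq)

  loop# : ∀ {i c} {p : Prog k} {σ τ ρ d e} → c (top σ i) ≡ true →
          p ⊢ σ ⇒ τ # d → while i c p ⊢ τ ⇒ ρ # e → while i c p ⊢ σ ⇒ ρ # suc d + e
  loop# {d = d} {e} eq r s = units (weaken bound (loop eq (steps r) (steps s)))
    where
    bound : suc (d * unit + e * unit) ≤ (suc d + e) * unit
    bound = subst (λ x → suc x ≤ (suc d + e) * unit) (*-distribʳ-+ unit d e)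
              (+-monoˡ-≤ ((d + e) * unit) (s≤s z≤n))

  iterations : ∀ n c → n * suc (c * unit) + 1 ≤ (n * suc c + 1) * unit
  iterations n c = begin
    n * suc (c * unit) + 1        ≤⟨ +-mono-≤ (*-monoʳ-≤ n (+-monoˡ-≤ (c * unit) (s≤s z≤n))) (s≤s z≤n) ⟩
    n * (suc c * unit) + 1 * unit ≡⟨ cong (_+ 1 * unit) (*-assoc n (suc c) unit) ⟨
    n * suc c * unit + 1 * unit   ≡⟨ *-distribʳ-+ unit (n * suc c) 1 ⟨
    (n * suc c + 1) * unit        ∎
    where open ≤-Reasoning

  countdown# : ∀ {i : Fin k} {p c} N (σ : ℕ → ℕ → Stacks k) →
    (∀ w d → isTrue (top (σ (suc w) d) i) ≡ true) →
    (∀ d → isTrue (top (σ zero d) i) ≡ false) →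
    (∀ w d → suc w + d ≡ N → p ⊢ σ (suc w) d ⇒ σ w (suc d) # c) →
    while i isTrue p ⊢ σ N 0 ⇒ σ 0 N # N * suc c + 1
  countdown# {c = c} N σ more done step =
    units (weaken (iterations N c) (countdown N σ more done (λ w d eq → steps (step w d eq))))

  drain# : ∀ {i : Fin k} {p c} (σ : Word → Word → Stacks k) →
    (∀ b w d → nonEmpty (top (σ (b ∷ w) d) i) ≡ true) →
    (∀ d → nonEmpty (top (σ [] d) i) ≡ false) →
    (∀ b w d → p ⊢ σ (b ∷ w) d ⇒ σ w (b ∷ d) # c) →
    ∀ w d → while i nonEmpty p ⊢ σ w d ⇒ σ [] (w ʳ++ d) # length w * suc c + 1
  drain# {c = c} σ more done step w d = units (weaken (iterations (length w) c)
    (drain σ more done (λ b w d → steps (step b w d)) w d))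

  emitReg# : ∀ {i o s} (rs : Vec ℕ m) r → lookup rs r ≤ K →
    emitReg r ⊢ ⟨ i , o , s ∣ rs ⟩ ⇒ ⟨ i , ones (lookup rs r) ++ o , s ∣ rs ⟩ # 1
  emitReg# rs r le = one-unit 10 2 le (weaken (≤-reflexive total) (emitReg-run rs r))
    where
    open +-*-Solver
    total : lookup rs r * 6 + 1 + (lookup rs r * 4 + 1) ≡ lookup rs r * 10 + 2
    total = solve 1 (λ n → n :* con 6 :+ con 1 :+ (n :* con 4 :+ con 1) := n :* con 10 :+ con 2)
              refl (lookup rs r)

  clear# : ∀ {i o s} (rs : Vec ℕ m) r → lookup rs r ≤ K →
    clear r ⊢ ⟨ i , o , s ∣ rs ⟩ ⇒ ⟨ i , o , s ∣ rs [ r ]≔ 0 ⟩ # 1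
  clear# rs r le = one-unit 2 1 le (clear-run rs r)

  readReg# : ∀ {i o s} (rs : Vec ℕ m) r n → lookup rs r ≡ 0 → n ≤ K →
    readReg r ⊢ ⟨ unary n ++ i , o , s ∣ rs ⟩ ⇒ ⟨ i , o , s ∣ rs [ r ]≔ n ⟩ # 1
  readReg# rs r n eq le =
    one-unit 4 2 le (weaken (≤-reflexive (+-assoc (n * 4) 1 1)) (readReg-run rs r n eq))

  emit# : ∀ {i o s} {rs : Vec ℕ m} → Bounded rs → ∀ xs →
    emit xs ⊢ ⟨ i , o , s ∣ rs ⟩ ⇒ ⟨ i , emitted rs xs o , s ∣ rs ⟩ # emitCost xs
  emit# bs []           = primitive# 1 skip
  emit# bs (lit b ∷ xs) = push# ⨾# emit# bs xs
  emit# {i = i} {o} {s} {rs} bs (num (one r) ∷ xs) =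
    emitReg# rs r (All.lookup bs (∈-lookup r rs)) ⨾#
    push# ⨾#
    start# (cong (λ o′ → ⟨ i , o′ , s ∣ rs ⟩) (sym (unary-ʳ++ (lookup rs r) o))) (emit# bs xs)
  emit# {i = i} {o} {s} {rs} bs (num (q ⊕ r) ∷ xs) =
    emitReg# rs q (All.lookup bs (∈-lookup q rs)) ⨾#
    emitReg# rs r (All.lookup bs (∈-lookup r rs)) ⨾#
    push# ⨾#
    start# (cong (λ o′ → ⟨ i , o′ , s ∣ rs ⟩) (trans (sym (unary-ʳ++ y (ones x ++ o))) (unary-+-ʳ++ x y o)))
           (emit# bs xs)
    where
    x = lookup rs q
    y = lookup rs r

-- With register contents linear in ℓ, a unit is linear too, so linearly many units are
-- quadratically many steps. The program ends with an empty input stack and the output reversed;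
-- pouring the latter onto the former puts the output on the first tape in the right order.
polynomialTime : ∀ {P Q : Problem} {f} (p : Prog (4 + m)) c →
  (∀ i → let ℓ = length (encode P i) in ∃[ σ ]
     Units._⊢_⇒_#_ (2 * suc ℓ) p ⟨ encode P i , [] , [] ∣ Vec.replicate m 0 ⟩
       ([] ∷ (encode Q (f i) ʳ++ []) ∷ σ) (c * suc ℓ)) →
  PolynomialTime P Q f
polynomialTime {m} {P} {Q} {f} p c run =
  machine (p ⨾ pour) , C * 7 + 1 , 2 , computes-f
  where
  blanks : ∀ m → Vec.map ones (Vec.replicate m 0) ≡ Vec.replicate m []
  blanks zero    = refl
  blanks (suc m) = cong ([] ∷_) (blanks m)

  shift-run : ∀ {τ : Stacks (2 + m)} b w d →
    shift out inp ⊢ d ∷ (b ∷ w) ∷ τ ⇒ (b ∷ d) ∷ w ∷ τ within 4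
  shift-run true  w d = then refl (pop refl ⨾ push)
  shift-run false w d = else refl (pop refl ⨾ push)

  square : ∀ n → n ≤ n ^ 2
  square zero    = z≤n
  square (suc n) = m≤m*n (suc n) (suc n ^ 1)

  open ≤-Reasoning
  open +-*-Solver

  -- The run itself, plus 5 steps of `pour` for every output bit, of which there are at most as many
  -- as the run has steps.
  C = 6 * (c * 10)

  product : ∀ ℓ → suc ℓ * suc (2 * suc ℓ) ≤ 7 * ℓ ^ 2 + 3
  product ℓ = begin
    suc ℓ * suc (2 * suc ℓ)   ≡⟨ solve 1 (λ ℓ → (con 1 :+ ℓ) :* (con 1 :+ con 2 :* (con 1 :+ ℓ))
                                           := con 2 :* ℓ :^ 2 :+ con 5 :* ℓ :+ con 3) refl ℓ ⟩
    2 * ℓ ^ 2 + 5 * ℓ + 3     ≤⟨ +-monoˡ-≤ 3 (+-monoʳ-≤ (2 * ℓ ^ 2) (*-monoʳ-≤ 5 (square ℓ))) ⟩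
    2 * ℓ ^ 2 + 5 * ℓ ^ 2 + 3 ≡⟨ cong (_+ 3) (*-distribʳ-+ (ℓ ^ 2) 2 5) ⟨
    7 * ℓ ^ 2 + 3             ∎

  bound : ∀ ℓ {s} → let time = c * suc ℓ * (10 * suc (2 * suc ℓ)) in
    s ≤ time + 0 → time + (s * 5 + 1) ≤ (C * 7 + 1) * ℓ ^ 2 + (C * 7 + 1)
  bound ℓ {s} s≤ = begin
    time + (s * 5 + 1)              ≤⟨ +-monoʳ-≤ time (+-monoˡ-≤ 1 (*-monoˡ-≤ 5 s≤)) ⟩
    time + ((time + 0) * 5 + 1)
      ≡⟨ solve 3 (λ c a b → c :* a :* (con 10 :* b) :+ ((c :* a :* (con 10 :* b) :+ con 0) :* con 5 :+ con 1)
                         := con 6 :* (c :* con 10) :* (a :* b) :+ con 1) refl c (suc ℓ) (suc (2 * suc ℓ)) ⟩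
    C * (suc ℓ * suc (2 * suc ℓ)) + 1 ≤⟨ +-monoˡ-≤ 1 (*-monoʳ-≤ C (product ℓ)) ⟩
    -- Slack that makes coefficient and constant term equal, as the bound `c * ℓ ^ d + c` in
    -- `PolynomialTime` requires.
    C * (7 * q + 3) + 1             ≤⟨ m≤m+n _ (C * 4 + q) ⟩
    C * (7 * q + 3) + 1 + (C * 4 + q)
      ≡⟨ solve 2 (λ C q → C :* (con 7 :* q :+ con 3) :+ con 1 :+ (C :* con 4 :+ q)
                      := (C :* con 7 :+ con 1) :* q :+ (C :* con 7 :+ con 1)) refl C q ⟩
    (C * 7 + 1) * q + (C * 7 + 1)   ∎
    where
    time = c * suc ℓ * (10 * suc (2 * suc ℓ))
    q = ℓ ^ 2

  pour : Prog (4 + m)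
  pour = while out nonEmpty (shift out inp)

  pour-run : ∀ v (τ : Stacks (2 + m)) →
    pour ⊢ [] ∷ (v ʳ++ []) ∷ τ ⇒ v ∷ [] ∷ τ within length (v ʳ++ []) * 5 + 1
  pour-run v τ = finish-≡ (cong (_∷ [] ∷ τ) (trans (ʳ++-ʳ++ v) (++-identityʳ v)))
    (drain (λ w d → d ∷ w ∷ τ) (λ _ _ _ → refl) (λ _ → refl) shift-run (v ʳ++ []) [])

  computes-f : ∀ i → ∃[ t ] t ≤ (C * 7 + 1) * length (encode P i) ^ 2 + (C * 7 + 1) ×
               Computes machine (p ⨾ pour) ↦ encode P i within (encode Q (f i)) t
  computes-f i with run i
  ... | σ , r with computes (start-≡ (cong (λ τ → encode P i ∷ [] ∷ [] ∷ [] ∷ τ) (sym (blanks m)))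
                                     (Units.steps r ⨾ pour-run (encode Q (f i)) σ))
  ... | t , t≤ , c = t , ≤-trans t≤ (bound (length (encode P i)) (height-grows out (Units.steps r))) , c

-- Indexing by natural numbers, and exhaustive search

-- Indices beyond the range go to the last element.
clamp : ℕ → Fin (suc n)
clamp         zero    = zero
clamp {zero}  (suc _) = zero
clamp {suc _} (suc i) = suc (clamp i)

toℕ-clamp : ∀ {i} → i ≤ n → toℕ (clamp {n} i) ≡ i
toℕ-clamp z≤n       = refl
toℕ-clamp (s≤s i≤n) = cong suc (toℕ-clamp i≤n)

clamp-toℕ : (i : Fin (suc n)) → clamp (toℕ i) ≡ i
clamp-toℕ i = toℕ-injective (toℕ-clamp (toℕ≤pred[n] i))

infixl 9 _‼_

-- Numbers are what the machines handle. With a total lookup, the constructions carry no bounds;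
-- these appear as hypotheses of lemmas.
_‼_ : Vec Bool (suc n) → ℕ → Bool
v ‼ i = lookup v (clamp i)

‼-∷ʳ : ∀ (v : Vec Bool (suc n)) b {i} → i ≤ n → (v ∷ʳ b) ‼ i ≡ v ‼ i
‼-∷ʳ (_ ∷ _) b z≤n             = refl
‼-∷ʳ (_ ∷ v@(_ ∷ _)) b (s≤s i≤n) = ‼-∷ʳ v b i≤n

last-∷ʳ : ∀ (v : Vec Bool (suc n)) b → (v ∷ʳ b) ‼ suc n ≡ b
last-∷ʳ (_ ∷ [])        b = refl
last-∷ʳ (_ ∷ v@(_ ∷ _)) b = last-∷ʳ v b

-- Makes the classical case distinctions about strategies constructive, as there are only finitely
-- many of them.
search : ∀ n {P Q : Vec Bool n → Set} → (∀ v → P v ⊎ Q v) → (∀ v → P v) ⊎ (∃[ v ] Q v)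
search zero f with f []
... | inj₁ p = inj₁ λ { [] → p }
... | inj₂ q = inj₂ ([] , q)
search (suc n) f with search n (f ∘ (true ∷_)) | search n (f ∘ (false ∷_))
... | inj₂ (v , q) | _            = inj₂ (true ∷ v , q)
... | inj₁ _       | inj₂ (v , q) = inj₂ (false ∷ v , q)
... | inj₁ p       | inj₁ p′      = inj₁ λ { (true ∷ v) → p v ; (false ∷ v) → p′ v }

true-or-false : ∀ b → b ≡ true ⊎ b ≡ false
true-or-false true  = inj₁ refl
true-or-false false = inj₂ refl

-- From formulas to circuits

Variables : ℕ → Set
Variables n = Fin n ⊎ Fin n

-- The strategies are b ∷ x. Bit b is wire 0, and wire n + 1 is the unused
-- first bit of the other player.
wire : Variables n → ℕ
wire     (inj₁ i) = suc (toℕ i)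
wire {n} (inj₂ j) = suc n + suc (toℕ j)

-- The wire of the formula's value, if l is the last wire before its gates.
last : Formula (Variables n) → ℕ → ℕ
last (var _)  l = suc l
last (¬′ φ)   l = suc (last φ l)
last (φ ∧′ χ) l = suc (last χ (last φ l))
last (φ ∨′ χ) l = suc (last χ (last φ l))

-- In continuation-passing style: a circuit starts with its first gate and its type counts the wires
-- so far, so what follows is a function of the last wire. A variable gets a gate as well, the AND
-- of its wire with itself, so that the value of every subformula is on the last wire of its own
-- block of gates.
compile : Formula (Variables n) → ∀ l → (∀ l → Circuit (suc l) k) → Circuit (suc l) k
compile (var v)  l k = gate (AND (clamp (wire v)) (clamp (wire v))) (k (suc l))
compile (¬′ φ)   l k = compile φ l λ l₁ → gate (NOT (clamp l₁)) (k (suc l₁))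
compile (φ ∧′ χ) l k = compile φ l λ l₁ → compile χ l₁ λ l₂ →
                       gate (AND (clamp l₁) (clamp l₂)) (k (suc l₂))
compile (φ ∨′ χ) l k = compile φ l λ l₁ → compile χ l₁ λ l₂ →
                       gate (OR (clamp l₁) (clamp l₂)) (k (suc l₂))

-- Payoff 2^n if b and ψ hold, 0 if only b holds, and 2^n - 1 if b fails.
payoffs : ∀ n l → Circuit (suc l) (suc n)
payoffs n l = gate (NOT (clamp 0)) (gate (AND (clamp 0) (clamp l))
  (outputs (clamp (2 + l) ∷ Vec.replicate n (clamp (1 + l)))))

gameCircuit : ∀ n → Formula (Variables n) → Circuit (suc n + suc n) (suc n)
gameCircuit n ψ = compile ψ (n + suc n) (payoffs n)

size : Formula (Variables n) → ℕ
size (var _)  = 1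
size (¬′ φ)   = suc (size φ)
size (φ ∧′ χ) = suc (size φ + size χ)
size (φ ∨′ χ) = suc (size φ + size χ)

+-nest : ∀ a b l {x y} → x ≡ a + l → y ≡ b + x → y ≡ a + b + l
+-nest a b l refl refl = trans (sym (+-assoc b a l)) (cong (_+ l) (+-comm b a))

last-size : ∀ (φ : Formula (Variables n)) l → last φ l ≡ size φ + l
last-size (var _)  l = refl
last-size (¬′ φ)   l = cong suc (last-size φ l)
last-size (φ ∧′ χ) l = cong suc (+-nest (size φ) (size χ) l (last-size φ l) (last-size χ _))
last-size (φ ∨′ χ) l = cong suc (+-nest (size φ) (size χ) l (last-size φ l) (last-size χ _))

≤-last : ∀ (φ : Formula (Variables n)) l → l ≤ last φ l
≤-last φ l = ≤-trans (m≤n+m l (size φ)) (≤-reflexive (sym (last-size φ l)))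

_Extends_ : Vec Bool (suc m) → Vec Bool (suc n) → Set
_Extends_ {n = n} v′ v = ∀ i → i ≤ n → v′ ‼ i ≡ v ‼ i

-- The vector `v′` is what the continuation is evaluated on. That it extends `v` is part of the
-- induction because the value of a left operand must survive the gates of the right one.
compile-correct : ∀ (φ : Formula (Variables n)) {l} (k : ∀ l → Circuit (suc l) m) ρ v →
  (∀ x → wire x ≤ l × v ‼ wire x ≡ ρ x) →
  ∃[ v′ ] v′ Extends v × v′ ‼ last φ l ≡ eval ρ φ ×
          evalCircuit (compile φ l k) v ≡ evalCircuit (k (last φ l)) v′
compile-correct (var x) k ρ v ok =
  _ , (λ _ → ‼-∷ʳ v _) ,
  trans (last-∷ʳ v _) (trans (Bool.∧-idem _) (proj₂ (ok x))) , refl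
compile-correct (¬′ φ) k ρ v ok with compile-correct φ _ ρ v ok
... | v₁ , ext , val , eq =
  _ , (λ i i≤ → trans (‼-∷ʳ v₁ _ (≤-trans i≤ (≤-last φ _))) (ext i i≤)) ,
  trans (last-∷ʳ v₁ _) (cong not val) , eq
compile-correct (φ ∧′ χ) {l} k ρ v ok with compile-correct φ _ ρ v ok
... | v₁ , ext₁ , val₁ , eq₁
    with compile-correct χ _ ρ v₁ (λ x → ≤-trans (proj₁ (ok x)) (≤-last φ l) ,
                                         trans (ext₁ _ (proj₁ (ok x))) (proj₂ (ok x)))
... | v₂ , ext₂ , val₂ , eq₂ =
  _ , (λ i i≤ → trans (‼-∷ʳ v₂ _ (≤-trans i≤ (≤-trans (≤-last φ l) (≤-last χ _))))
                      (trans (ext₂ i (≤-trans i≤ (≤-last φ l))) (ext₁ i i≤))) ,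
  trans (last-∷ʳ v₂ _) (cong₂ _∧_ (trans (ext₂ _ ≤-refl) val₁) val₂) , trans eq₁ eq₂
compile-correct (φ ∨′ χ) {l} k ρ v ok with compile-correct φ _ ρ v ok
... | v₁ , ext₁ , val₁ , eq₁
    with compile-correct χ _ ρ v₁ (λ x → ≤-trans (proj₁ (ok x)) (≤-last φ l) ,
                                         trans (ext₁ _ (proj₁ (ok x))) (proj₂ (ok x)))
... | v₂ , ext₂ , val₂ , eq₂ =
  _ , (λ i i≤ → trans (‼-∷ʳ v₂ _ (≤-trans i≤ (≤-trans (≤-last φ l) (≤-last χ _))))
                      (trans (ext₂ i (≤-trans i≤ (≤-last φ l))) (ext₁ i i≤))) ,
  trans (last-∷ʳ v₂ _) (cong₂ _∨_ (trans (ext₂ _ ≤-refl) val₁) val₂) , trans eq₁ eq₂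

payoffBits : Bool → Bool → Vec Bool (suc n)
payoffBits {n} b p = (b ∧ p) ∷ Vec.replicate n (not b)

wire-value : ∀ b c (x y : Vec Bool n) v →
  wire v ≤ n + suc n × ((b ∷ x) Vec.++ (c ∷ y)) ‼ wire v ≡ [ lookup x , lookup y ] v
wire-value {n} b c x y (inj₁ i) =
  ≤-trans (≤-trans (toℕ<n i) (m≤m+n n (suc n))) ≤-refl , (begin
  ((b ∷ x) Vec.++ (c ∷ y)) ‼ suc (toℕ i)
    ≡⟨ cong (((b ∷ x) Vec.++ (c ∷ y)) ‼_) (toℕ-↑ˡ (suc i) (suc n)) ⟨
  ((b ∷ x) Vec.++ (c ∷ y)) ‼ toℕ (suc i ↑ˡ suc n)
    ≡⟨ cong (lookup ((b ∷ x) Vec.++ (c ∷ y))) (clamp-toℕ (suc i ↑ˡ suc n)) ⟩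
  lookup ((b ∷ x) Vec.++ (c ∷ y)) (suc i ↑ˡ suc n)
    ≡⟨ lookup-++ˡ (b ∷ x) (c ∷ y) (suc i) ⟩
  lookup x i ∎)
  where open ≡-Reasoning
wire-value {n} b c x y (inj₂ j) =
  ≤-trans (≤-reflexive (sym (+-suc n _))) (+-monoʳ-≤ n (s≤s (toℕ<n j))) , (begin
  ((b ∷ x) Vec.++ (c ∷ y)) ‼ (suc n + suc (toℕ j))
    ≡⟨ cong (((b ∷ x) Vec.++ (c ∷ y)) ‼_) (toℕ-↑ʳ (suc n) (suc j)) ⟨
  ((b ∷ x) Vec.++ (c ∷ y)) ‼ toℕ (suc n ↑ʳ suc j)
    ≡⟨ cong (lookup ((b ∷ x) Vec.++ (c ∷ y))) (clamp-toℕ (suc n ↑ʳ suc j)) ⟩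
  lookup ((b ∷ x) Vec.++ (c ∷ y)) (suc n ↑ʳ suc j)
    ≡⟨ lookup-++ʳ (b ∷ x) (c ∷ y) (suc j) ⟩
  lookup y j ∎)
  where open ≡-Reasoning

gameCircuit-correct : ∀ (ψ : Formula (Variables n)) b c x y →
  evalCircuit (gameCircuit n ψ) ((b ∷ x) Vec.++ (c ∷ y)) ≡
  payoffBits b (eval [ lookup x , lookup y ] ψ)
gameCircuit-correct {n} ψ b c x y
  with compile-correct ψ (payoffs n) _ ((b ∷ x) Vec.++ (c ∷ y)) (wire-value b c x y)
... | v , ext , val , eq = trans eq (cong₂ _∷_ first rest)
  where
  v₁ = v ∷ʳ not (v ‼ 0)
  v₂ = v₁ ∷ʳ (v₁ ‼ 0 ∧ v₁ ‼ last ψ (n + suc n))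
  v₁-0 : v₁ ‼ 0 ≡ b
  v₁-0 = trans (‼-∷ʳ v _ z≤n) (ext 0 z≤n)
  first : v₂ ‼ (2 + last ψ (n + suc n)) ≡ b ∧ _
  first = trans (last-∷ʳ v₁ _) (cong₂ _∧_ v₁-0 (trans (‼-∷ʳ v _ ≤-refl) val))
  second : v₂ ‼ (1 + last ψ (n + suc n)) ≡ not b
  second = trans (‼-∷ʳ v₁ _ ≤-refl) (trans (last-∷ʳ v _) (cong not (ext 0 z≤n)))
  rest : Vec.map (lookup v₂) (Vec.replicate n (clamp (1 + last ψ (n + suc n)))) ≡ Vec.replicate n (not b)
  rest = trans (map-replicate (lookup v₂) _ n) (cong (Vec.replicate n) second)

-- The three payoffs and the correctness of the game

payoff : ∀ n → Bool → Bool → ℕ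
payoff n b p = value (payoffBits {n} b p)

value-falses : ∀ n → value (Vec.replicate n false) ≡ 0
value-falses zero    = refl
value-falses (suc n) = value-falses n

value-trues : ∀ n → suc (value (Vec.replicate n true)) ≡ 2 ^ n
value-trues zero    = refl
value-trues (suc n) = begin
  suc (1 * 2 ^ n + value (Vec.replicate n true)) ≡⟨ +-suc (1 * 2 ^ n) _ ⟨
  1 * 2 ^ n + suc (value (Vec.replicate n true)) ≡⟨ cong (1 * 2 ^ n +_) (value-trues n) ⟩
  1 * 2 ^ n + 2 ^ n                              ≡⟨ +-comm (1 * 2 ^ n) (2 ^ n) ⟩
  2 ^ n + 1 * 2 ^ n                              ∎
  where open ≡-Reasoning

payoff-high : ∀ n → payoff n true true ≡ 2 ^ n
payoff-high n = trans (cong (1 * 2 ^ n +_) (value-falses n))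
                      (trans (+-identityʳ (1 * 2 ^ n)) (*-identityˡ (2 ^ n)))

payoff-low : ∀ n → payoff n true false ≡ 0
payoff-low = value-falses

payoff-middle : ∀ n p → suc (payoff n false p) ≡ 2 ^ n
payoff-middle n p = value-trues n

payoff-≤ : ∀ n b p → payoff n b p ≤ payoff n true true
payoff-≤ n true  true  = ≤-refl
payoff-≤ n true  false = ≤-trans (≤-reflexive (payoff-low n)) z≤n
payoff-≤ n false p     = ≤-trans (n≤1+n _) (≤-reflexive (trans (payoff-middle n p) (sym (payoff-high n))))

middle<high : ∀ n p → payoff n false p < payoff n true true
middle<high n p = ≤-reflexive (trans (payoff-middle n p) (sym (payoff-high n)))

low<high : ∀ n → payoff n true false < payoff n true true
low<high n = subst₂ _<_ (sym (payoff-low n)) (sym (payoff-high n)) (m^n>0 2 n)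

-- The exponent must be positive here: 2^n - 1 exceeds 0 only from n = 1 on.
low<middle : ∀ n p → payoff (suc n) true false < payoff (suc n) false p
low<middle n p = subst (_< payoff (suc n) false p) (sym (payoff-low (suc n)))
  (s≤s⁻¹ (subst (2 ≤_) (sym (payoff-middle (suc n) p)) (*-monoʳ-≤ 2 (m^n>0 2 n))))

Payoff : ∀ n → Circuit (n + n) n → Vec Bool n → Vec Bool n → ℕ
Payoff n C x y = value (evalCircuit C (x Vec.++ y))

-- Formulas have no constants, so none exists over empty sets of variables. This excludes n = 0,
-- where the low and the middle payoff coincide.
nonempty : Formula (Variables n) → Fin n
nonempty (var (inj₁ i)) = i
nonempty (var (inj₂ i)) = i
nonempty (¬′ φ)         = nonempty φ
nonempty (φ ∧′ χ)       = nonempty φ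
nonempty (φ ∨′ χ)       = nonempty φ

module Game {n} (ψ : Formula (Variables (suc n))) where

  holds : Vec Bool (suc n) → Vec Bool (suc n) → Bool
  holds x y = eval [ lookup x , lookup y ] ψ

  P : Vec Bool (2 + n) → Vec Bool (2 + n) → ℕ
  P = Payoff _ (gameCircuit _ ψ)

  P-payoff : ∀ b c x y → P (b ∷ x) (c ∷ y) ≡ payoff (suc n) b (holds x y)
  P-payoff b c x y = cong value (gameCircuit-correct ψ b c x y)

  Good : Vec Bool (suc n) → Set
  Good x = ∀ y → holds x y ≡ true

  P-good : ∀ {x} c y → Good x → P (true ∷ x) (c ∷ y) ≡ payoff (suc n) true true
  P-good c y good = trans (P-payoff true c _ y) (cong (payoff (suc n) true) (good y))

  Dominant : Vec Bool (2 + n) → Set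
  Dominant x = ∀ x′ y → x′ ≢ x → ∃[ y′ ] (P x y ≥ P x′ y × P x y′ > P x′ y′)

  good⇒dominant : ∀ x → Good x → (∀ {z} → Good z → x ≡ z) → Dominant (true ∷ x)
  good⇒dominant x good unique (b ∷ x′) y x′≢x =
    let y′ , lt = loses b x′ x′≢x
    in false ∷ y′ , best y , subst₂ _<_ (sym (P-payoff b false x′ y′)) (sym (P-good false y′ good)) lt
    where
    best : ∀ y → P (true ∷ x) y ≥ P (b ∷ x′) y
    best (c ∷ y) = subst₂ _≤_ (sym (P-payoff b c x′ y)) (sym (P-good c y good))
                     (payoff-≤ (suc n) b (holds x′ y))
    loses : ∀ b x′ → _≢_ {A = Vec Bool (2 + n)} (b ∷ x′) (true ∷ x) →
            ∃[ y′ ] payoff (suc n) b (holds x′ y′) < payoff (suc n) true true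
    -- Without the bit b, the payoff is below the maximum against every opponent, so the witness is
    -- arbitrary.
    loses false x′ _ = x′ , middle<high (suc n) (holds x′ x′)
    loses true x′ x′≢x with search (suc n) (true-or-false ∘ holds x′)
    ... | inj₁ good′     = ⊥-elim (x′≢x (cong (true ∷_) (sym (unique good′))))
    ... | inj₂ (y′ , eq) = y′ , subst (λ p → payoff (suc n) true p < payoff (suc n) true true) (sym eq)
                                  (low<high (suc n))

  dominant⇒true : ∀ {b x} → Dominant (b ∷ x) → b ≡ true
  dominant⇒true {true} _ = refl
  -- Flipping the first bit of the assignment gives another strategy without b to tie with.
  dominant⇒true {false} {a ∷ x} dom with dom (false ∷ not a ∷ x) (false ∷ a ∷ x) (other a)
    where
    other : ∀ a {x} → _≢_ {A = Vec Bool (2 + n)} (false ∷ not a ∷ x) (false ∷ a ∷ x)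
    other true  ()
    other false ()
  ... | c ∷ y′ , _ , gt = ⊥-elim (<-irrefl tie gt)
    where
    tie : P (false ∷ not a ∷ x) (c ∷ y′) ≡ P (false ∷ a ∷ x) (c ∷ y′)
    tie = trans (P-payoff false c (not a ∷ x) y′) (sym (P-payoff false c (a ∷ x) y′))

  dominant⇒good : ∀ {x} → Dominant (true ∷ x) → Good x
  dominant⇒good {x} dom y with holds x y in eq
  ... | true  = refl
  -- Where ψ fails, giving up the bit b raises the payoff from 0 to the middle one.
  ... | false with dom (false ∷ x) (false ∷ y) (λ ())
  ...   | _ , ge , _ = ⊥-elim (<⇒≱ (low<middle n (holds x y))
                         (subst₂ _≤_ (P-payoff false false x y)
                           (trans (P-payoff true false x y) (cong (payoff (suc n) true) eq)) ge))

  -- Another valid `z` would get the highest payoff against every opponent, so no strategy could be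
  -- strictly better than it.
  dominant⇒unique : ∀ {x} → Dominant (true ∷ x) → ∀ {z} → Good z → x ≡ z
  dominant⇒unique {x} dom {z} good with ≡-dec Bool._≟_ x z
  ... | yes x≡z = x≡z
  ... | no x≢z with dom (true ∷ z) (true ∷ z) (λ { refl → x≢z refl })
  ...   | c ∷ y′ , _ , gt = ⊥-elim (<⇒≱ gt (subst₂ _≤_ (sym (P-payoff true c x y′))
                              (sym (P-good c y′ good)) (payoff-≤ (suc n) true (holds x y′))))

game-correct : ∀ n (ψ : Formula (Variables n)) →
  Yes U∃∀-Sat (n , ψ) ⇔ Yes WDom-Strategy (suc n , gameCircuit n ψ)
game-correct zero    ψ with () ← nonempty ψ
game-correct (suc n) ψ = mk⇔
  (λ { (x , good , unique) → true ∷ x , good⇒dominant x good unique })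
  (λ { (b ∷ x , dom) → let dom′ = subst (λ b → Dominant (b ∷ x)) (dominant⇒true dom) dom
                       in x , dominant⇒good dom′ , dominant⇒unique dom′ })
  where open Game ψ

-- Encodings of formulas and game circuits

-- Defined with a tail r instead of _++_, so that parsing steps hold by computation.
tokens : Formula (Variables n) → Word → Word
tokens (var (inj₁ i)) r = false ∷ false ∷ unary (toℕ i) ++ r
tokens (var (inj₂ i)) r = false ∷ true ∷ unary (toℕ i) ++ r
tokens (¬′ φ)         r = tokens φ (true ∷ false ∷ r)
tokens (φ ∧′ χ)       r = tokens φ (tokens χ (true ∷ true ∷ false ∷ r))
tokens (φ ∨′ χ)       r = tokens φ (tokens χ (true ∷ true ∷ true ∷ r))

tokens-encode : ∀ (φ : Formula (Variables n)) r → encodeFormula φ ++ r ≡ tokens φ r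
tokens-encode₂ : ∀ (φ χ : Formula (Variables n)) t r →
  concatMap encodeToken (postfix φ ++ postfix χ ++ t ∷ []) ++ r ≡
  tokens φ (tokens χ (encodeToken t ++ r))
tokens-encode (var (inj₁ i)) r = cong (λ w → false ∷ false ∷ w ++ r) (++-identityʳ (encodeFin i))
tokens-encode (var (inj₂ i)) r = cong (λ w → false ∷ true ∷ w ++ r) (++-identityʳ (encodeFin i))
tokens-encode (¬′ φ) r = begin
  concatMap encodeToken (postfix φ ++ neg ∷ []) ++ r
    ≡⟨ cong (_++ r) (concatMap-++ encodeToken (postfix φ) (neg ∷ [])) ⟩
  (encodeFormula φ ++ true ∷ false ∷ []) ++ r
    ≡⟨ ++-assoc (encodeFormula φ) _ r ⟩
  encodeFormula φ ++ true ∷ false ∷ r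
    ≡⟨ tokens-encode φ _ ⟩
  tokens φ (true ∷ false ∷ r) ∎
  where open ≡-Reasoning
tokens-encode (φ ∧′ χ) r = tokens-encode₂ φ χ and r
tokens-encode (φ ∨′ χ) r = tokens-encode₂ φ χ or r
tokens-encode₂ φ χ t r = begin
  concatMap encodeToken (postfix φ ++ postfix χ ++ t ∷ []) ++ r
    ≡⟨ cong (_++ r) (concatMap-++ encodeToken (postfix φ) _) ⟩
  (encodeFormula φ ++ concatMap encodeToken (postfix χ ++ t ∷ [])) ++ r
    ≡⟨ ++-assoc (encodeFormula φ) _ r ⟩
  encodeFormula φ ++ concatMap encodeToken (postfix χ ++ t ∷ []) ++ r
    ≡⟨ cong (λ w → encodeFormula φ ++ w ++ r) (concatMap-++ encodeToken (postfix χ) (t ∷ [])) ⟩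
  encodeFormula φ ++ (encodeFormula χ ++ encodeToken t ++ []) ++ r
    ≡⟨ cong (λ w → encodeFormula φ ++ (encodeFormula χ ++ w) ++ r) (++-identityʳ (encodeToken t)) ⟩
  encodeFormula φ ++ (encodeFormula χ ++ encodeToken t) ++ r
    ≡⟨ cong (encodeFormula φ ++_) (++-assoc (encodeFormula χ) _ r) ⟩
  encodeFormula φ ++ encodeFormula χ ++ encodeToken t ++ r
    ≡⟨ cong (encodeFormula φ ++_) (tokens-encode χ _) ⟩
  encodeFormula φ ++ tokens χ (encodeToken t ++ r)
    ≡⟨ tokens-encode φ _ ⟩
  tokens φ (tokens χ (encodeToken t ++ r)) ∎
  where open ≡-Reasoning

notGate : ℕ → Word → Word
notGate i o = unary i ʳ++ (false ∷ true ∷ o)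

-- An AND gate for β = false, an OR gate for β = true.
binaryGate : Bool → ℕ → ℕ → Word → Word
binaryGate β i j o = unary j ʳ++ (unary i ʳ++ (β ∷ true ∷ true ∷ o))

-- Accumulated in reverse onto o, as on the output stack of the machine.
gates : Formula (Variables n) → ℕ → Word → Word
gates (var v)  l o = binaryGate false (wire v) (wire v) o
gates (¬′ φ)   l o = notGate (last φ l) (gates φ l o)
gates (φ ∧′ χ) l o = binaryGate false (last φ l) (last χ (last φ l)) (gates χ (last φ l) (gates φ l o))
gates (φ ∨′ χ) l o = binaryGate true (last φ l) (last χ (last φ l)) (gates χ (last φ l) (gates φ l o))

unary-clamp : ∀ {i} → i ≤ n → encodeFin (clamp {n} i) ≡ unary i
unary-clamp i≤n = cong unary (toℕ-clamp i≤n)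

encode-NOT : ∀ (C : Circuit (2 + n) m) o {i} → i ≤ n →
  encodeCircuit (gate (NOT (clamp i)) C) ʳ++ o ≡ encodeCircuit C ʳ++ notGate i o
encode-NOT C o {i} i≤n rewrite unary-clamp i≤n = ++-ʳ++ (true ∷ false ∷ unary i)

encode-pair : ∀ (u v w o : Word) → ((u ++ v) ++ w) ʳ++ o ≡ w ʳ++ (v ʳ++ (u ʳ++ o))
encode-pair u v w o = trans (++-ʳ++ (u ++ v)) (cong (w ʳ++_) (++-ʳ++ u))

encode-AND : ∀ (C : Circuit (2 + n) m) o {i j} → i ≤ n → j ≤ n →
  encodeCircuit (gate (AND (clamp i) (clamp j)) C) ʳ++ o ≡ encodeCircuit C ʳ++ binaryGate false i j o
encode-AND C o {i} {j} i≤n j≤n rewrite unary-clamp i≤n | unary-clamp j≤n =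
  encode-pair (unary i) (unary j) (encodeCircuit C) (false ∷ true ∷ true ∷ o)

encode-OR : ∀ (C : Circuit (2 + n) m) o {i j} → i ≤ n → j ≤ n →
  encodeCircuit (gate (OR (clamp i) (clamp j)) C) ʳ++ o ≡ encodeCircuit C ʳ++ binaryGate true i j o
encode-OR C o {i} {j} i≤n j≤n rewrite unary-clamp i≤n | unary-clamp j≤n =
  encode-pair (unary i) (unary j) (encodeCircuit C) (true ∷ true ∷ true ∷ o)

gates-encode : ∀ (φ : Formula (Variables n)) {l} (k : ∀ l → Circuit (suc l) m) o →
  (∀ (v : Variables n) → wire v ≤ l) →
  encodeCircuit (compile φ l k) ʳ++ o ≡ encodeCircuit (k (last φ l)) ʳ++ gates φ l o
gates-encode (var v) k o ok = encode-AND (k _) o (ok v) (ok v)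
gates-encode (¬′ φ)  k o ok = trans (gates-encode φ _ o ok) (encode-NOT (k _) _ ≤-refl)
gates-encode (φ ∧′ χ) {l} k o ok =
  trans (gates-encode φ _ o ok)
  (trans (gates-encode χ _ (gates φ l o) (λ v → ≤-trans (ok v) (≤-last φ l)))
         (encode-AND (k _) _ (≤-last χ _) ≤-refl))
gates-encode (φ ∨′ χ) {l} k o ok =
  trans (gates-encode φ _ o ok)
  (trans (gates-encode χ _ (gates φ l o) (λ v → ≤-trans (ok v) (≤-last φ l)))
         (encode-OR (k _) _ (≤-last χ _) ≤-refl))

copies : ℕ → ℕ → Word → Word
copies i zero    o = o
copies i (suc n) o = unary i ʳ++ copies i n o

-- The encoding puts its first word onto `o` first, `copies` its outermost word last, as a loop of
-- the machine does. The words being equal, the order does not matter.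
copies-encode : ∀ (i : Fin m) n o → encodeOutputs (Vec.replicate n i) ʳ++ o ≡ copies (toℕ i) n o
copies-encode i zero    o = refl
copies-encode i (suc n) o =
  trans (++-ʳ++ (encodeFin i)) (trans (copies-encode i n (encodeFin i ʳ++ o)) (rotate n))
  where
  rotate : ∀ n → copies (toℕ i) n (encodeFin i ʳ++ o) ≡ copies (toℕ i) (suc n) o
  rotate zero    = refl
  rotate (suc n) = cong (encodeFin i ʳ++_) (rotate n)

payoffGates : ℕ → ℕ → Word → Word
payoffGates n l o =
  copies (1 + l) n (unary (2 + l) ʳ++ (false ∷ binaryGate false 0 l (notGate 0 o)))

payoffs-encode : ∀ n l o → encodeCircuit (payoffs n l) ʳ++ o ≡ payoffGates n l o
payoffs-encode n l o = begin
  encodeCircuit (payoffs n l) ʳ++ o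
    ≡⟨ encode-NOT {n = l} (gate (AND (clamp 0) (clamp l)) outs) o z≤n ⟩
  encodeCircuit (gate (AND (clamp 0) (clamp l)) outs) ʳ++ notGate 0 o
    ≡⟨ encode-AND {n = suc l} outs _ z≤n (n≤1+n l) ⟩
  encodeCircuit outs ʳ++ o₂
    ≡⟨ ++-ʳ++ (false ∷ encodeFin first) ⟩
  encodeOutputs (Vec.replicate n rest) ʳ++ (encodeFin first ʳ++ (false ∷ o₂))
    ≡⟨ copies-encode rest n _ ⟩
  copies (toℕ rest) n (encodeFin first ʳ++ (false ∷ o₂))
    ≡⟨ cong₂ (λ i w → copies i n (w ʳ++ (false ∷ o₂)))
             (toℕ-clamp {2 + l} (n≤1+n (1 + l))) (unary-clamp {2 + l} ≤-refl) ⟩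
  payoffGates n l o ∎
  where
  open ≡-Reasoning
  first rest : Fin (3 + l)
  first = clamp (2 + l)
  rest  = clamp (1 + l)
  outs : Circuit (3 + l) (suc n)
  outs = outputs (first ∷ Vec.replicate n rest)
  o₂ = binaryGate false 0 l (notGate 0 o)

game-encode : ∀ n (ψ : Formula (Variables n)) →
  encode WDom-Strategy (suc n , gameCircuit n ψ) ʳ++ [] ≡
  payoffGates n (last ψ (n + suc n)) (gates ψ (n + suc n) (unary (suc n) ʳ++ []))
game-encode n ψ =
  trans (++-ʳ++ (unary (suc n)))
  (trans (gates-encode ψ (payoffs n) _ (λ v → proj₁ (wire-value false false xs xs v)))
         (payoffs-encode n _ _))
  where xs = Vec.replicate n false

length-suffix : ∀ (u v : Word) → length v ≤ length (u ++ v)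
length-suffix u v = ≤-trans (m≤n+m (length v) (length u)) (≤-reflexive (sym (length-++ u)))

length-unary : ∀ n (w : Word) → length (unary n ++ w) ≡ suc n + length w
length-unary zero    w = refl
length-unary (suc n) w = cong suc (length-unary n w)

-- The machine turning formulas into circuits
module ToGame where

  -- A holds an index read from the input, N the number of strategy bits, and L
  -- the last wire. The auxiliary stack holds the wires of the subformulas that
  -- still wait for a connective, except the latest one, which is always L.
  pattern A = zero
  pattern N = suc zero
  pattern L = suc (suc zero)

  pushLast readWire negation connective token header footer program : Prog 7

  -- The first wire of each player does not carry a variable, so the offset of variable i is i + 1.
  readWire = readReg A ⨾ push (reg A) true

  pushLast = push aux false ⨾
    while (reg L) isTrue (pop (reg L) ⨾ push tmp true ⨾ push aux true) ⨾
    while tmp isTrue (pop tmp ⨾ push (reg L) true)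

  variableGate : Index 3 → Prog 7
  variableGate x = readWire ⨾ pushLast ⨾ emit (lit true ∷ lit true ∷ lit false ∷ num x ∷ num x ∷ []) ⨾
                   clear A ⨾ push (reg L) true

  negation = emit (lit true ∷ lit false ∷ num (one L) ∷ []) ⨾ push (reg L) true

  connectiveGate : Bool → Prog 7
  connectiveGate β = emit (lit true ∷ lit true ∷ lit β ∷ []) ⨾
    while aux isTrue (pop aux ⨾ push out true) ⨾ pop aux ⨾ push out false ⨾
    emit (num (one L) ∷ []) ⨾ push (reg L) true

  connective = ifTop inp isTrue (pop inp ⨾ connectiveGate true) (pop inp ⨾ connectiveGate false)

  token = ifTop inp isTrue
    (pop inp ⨾ ifTop inp isTrue (pop inp ⨾ connective) (pop inp ⨾ negation))
    (pop inp ⨾ ifTop inp isTrue (pop inp ⨾ variableGate (N ⊕ A)) (pop inp ⨾ variableGate (one A)))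

  -- The pushes before the loop account for the additional bit b: they make N equal to n + 1 and L
  -- to 2n + 1, the last input wire of the game.
  header = push out true ⨾ push (reg N) true ⨾ push (reg L) true ⨾
    while inp isTrue (pop inp ⨾ push out true ⨾ push (reg N) true ⨾
                      push (reg L) true ⨾ push (reg L) true) ⨾
    pop inp ⨾ push out false

  footer =
    -- The NOT of wire 0 and the AND of wire 0 with wire `l`, where index 0 is the single bit
    -- `false`. They become wires `l + 1` and `l + 2`; the latter is the first output, the former
    -- all others.
    emit (lit true ∷ lit false ∷ lit false ∷
          lit true ∷ lit true ∷ lit false ∷ lit false ∷ num (one L) ∷ []) ⨾
    push (reg L) true ⨾ push (reg L) true ⨾ emit (lit false ∷ num (one L) ∷ []) ⨾
    pop (reg L) ⨾ pop (reg N) ⨾ while (reg N) isTrue (pop (reg N) ⨾ emit (num (one L) ∷ []))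

  program = header ⨾ while inp nonEmpty token ⨾ footer

  module _ (K : ℕ) where
    open Units K

    state : Word → Word → Word → ℕ → ℕ → ℕ → Stacks 7
    state i o s a n l = ⟨ i , o , s ∣ a ∷ n ∷ l ∷ [] ⟩

    header-run : ∀ {i} n →
      header ⊢ state (unary n ++ i) [] [] 0 0 0 ⇒ state i (unary (suc n) ʳ++ []) [] 0 (suc n) (n + suc n)
             # n * 6 + 6
    header-run {i} n = weaken# (≤-reflexive cost)
      (push# ⨾# push# ⨾# push# ⨾#
       countdown# n (λ w d → state (unary w ++ i) (ones d ++ true ∷ []) [] 0 (suc d) (1 + d * 2))
         (λ _ _ → refl) (λ _ → refl)
         (λ _ _ _ → pop# refl ⨾# push# ⨾# push# ⨾# push# ⨾# push#) ⨾#
       pop# refl ⨾#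
       finish# (cong₂ (λ o l → state i o [] 0 (suc n) l) out≡ last≡) push#)
      where
      open +-*-Solver
      out≡ : false ∷ ones n ++ true ∷ [] ≡ unary (suc n) ʳ++ []
      out≡ = sym (unary-ʳ++ n (true ∷ []))
      cost : 3 + (n * 6 + 1 + 2) ≡ n * 6 + 6
      cost = solve 1 (λ n → con 3 :+ (n :* con 6 :+ con 1 :+ con 2) := n :* con 6 :+ con 6) refl n
      last≡ : 1 + n * 2 ≡ n + suc n
      last≡ = solve 1 (λ n → con 1 :+ n :* con 2 := n :+ (con 1 :+ n)) refl n

    pushLast-run : ∀ {i o s a n} l → l ≤ K →
      pushLast ⊢ state i o s a n l ⇒ state i o (unary l ++ s) a n l # 2
    pushLast-run {i} {o} {s} {a} {n} l l≤K = push# ⨾# one-unit 10 2 l≤K (weaken (≤-reflexive total)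
      (countdown l (λ w d → i ∷ o ∷ ones d ∷ (unary d ++ s) ∷ ones a ∷ ones n ∷ ones w ∷ [])
         (λ _ _ → refl) (λ _ → refl) (λ _ _ _ → pop refl ⨾ push ⨾ push) ⨾
       countdown l (λ w d → i ∷ o ∷ ones w ∷ (unary l ++ s) ∷ ones a ∷ ones n ∷ ones d ∷ [])
         (λ _ _ → refl) (λ _ → refl) (λ _ _ _ → pop refl ⨾ push)))
      where
      open +-*-Solver
      total : l * 6 + 1 + (l * 4 + 1) ≡ l * 10 + 2
      total = solve 1 (λ n → n :* con 6 :+ con 1 :+ (n :* con 4 :+ con 1) := n :* con 10 :+ con 2) refl l

    variableGate-run : ∀ {i o s l n} x a → a < n → n ≤ K → l ≤ K → emitCost (num x ∷ num x ∷ []) ≤ 7 →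
      variableGate x ⊢ state (unary a ++ i) o s 0 n l
                     ⇒ state i (emitted (suc a ∷ n ∷ l ∷ []) (num x ∷ num x ∷ []) (false ∷ true ∷ true ∷ o))
                             (unary l ++ s) 0 n (suc l) # 16
    variableGate-run {l = l} {n} x a a<n n≤K l≤K cost = weaken# (+-monoʳ-≤ 4 (+-monoˡ-≤ 2 (+-monoʳ-≤ 3 cost)))
      ((readReg# (0 ∷ n ∷ l ∷ []) A a refl (≤-trans (<⇒≤ a<n) n≤K) ⨾# push#) ⨾#
       pushLast-run l l≤K ⨾#
       emit# bounds (lit true ∷ lit true ∷ lit false ∷ num x ∷ num x ∷ []) ⨾#
       clear# (suc a ∷ n ∷ l ∷ []) A (≤-trans a<n n≤K) ⨾#
       push#)
      where
      bounds : Bounded (suc a ∷ n ∷ l ∷ [])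
      bounds = ≤-trans a<n n≤K ∷ n≤K ∷ l≤K ∷ []

    negation-run : ∀ {i o s n l} → n ≤ K → l ≤ K →
      negation ⊢ state i o s 0 n l ⇒ state i (notGate l o) s 0 n (suc l) # 6
    negation-run n≤K l≤K = emit# (z≤n ∷ n≤K ∷ l≤K ∷ []) (lit true ∷ lit false ∷ num (one L) ∷ []) ⨾# push#

    connectiveGate-run : ∀ {i o s n l} β j → n ≤ K → j ≤ K → l ≤ K →
      connectiveGate β ⊢ state i o (unary j ++ s) 0 n l
                       ⇒ state i (binaryGate β j l o) s 0 n (suc l) # 11
    connectiveGate-run {i} {o} {s} {n} {l} β j n≤K j≤K l≤K =
      emit# (z≤n ∷ n≤K ∷ l≤K ∷ []) (lit true ∷ lit true ∷ lit β ∷ []) ⨾#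
      one-unit 4 1 j≤K (countdown j (λ w d → state i (ones d ++ β ∷ true ∷ true ∷ o) (unary w ++ s) 0 n l)
        (λ _ _ → refl) (λ _ → refl) (λ _ _ _ → pop refl ⨾ push)) ⨾#
      pop# refl ⨾#
      finish# (cong (λ o → state i o s 0 n l) (sym (unary-ʳ++ j (β ∷ true ∷ true ∷ o)))) push# ⨾#
      emit# (z≤n ∷ n≤K ∷ l≤K ∷ []) (num (one L) ∷ []) ⨾# push#

    -- A token takes at most 20 units, a number attained by variables, and one for the test of the
    -- loop. The continuation-passing form is that of `formula-run`.
    loopCost : Formula (Variables n) → ℕ → ℕ
    loopCost (var _)  c = 21 + c
    loopCost (¬′ φ)   c = loopCost φ (21 + c)
    loopCost (φ ∧′ χ) c = loopCost φ (loopCost χ (21 + c))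
    loopCost (φ ∨′ χ) c = loopCost φ (loopCost χ (21 + c))

    token-loop : ∀ {σ τ ρ c d} → nonEmpty (top σ inp) ≡ true → c ≤ 20 → token ⊢ σ ⇒ τ # c →
      while inp nonEmpty token ⊢ τ ⇒ ρ # d → while inp nonEmpty token ⊢ σ ⇒ ρ # 21 + d
    token-loop ne c≤ r s = loop# ne (weaken# c≤ r) s

    -- Invariant: reading a formula pushes onto `aux` the value that L had before. After both
    -- operands of a connective, the top is thus the value of L before `χ`, which is the wire of
    -- `φ`; popping it leaves just what `φ` has pushed. The rest of the run is a hypothesis because
    -- a single loop reads the tokens of all subformulas.
    formula-run : ∀ (φ : Formula (Variables n)) {r o s l τ c} → suc n ≤ K → last φ l ≤ K →
      while inp nonEmpty token ⊢ state r (gates φ l o) (unary l ++ s) 0 (suc n) (last φ l) ⇒ τ # c →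
      while inp nonEmpty token ⊢ state (tokens φ r) o s 0 (suc n) l ⇒ τ # loopCost φ c
    formula-run (var (inj₁ i)) n≤K l<K rest = token-loop refl ≤-refl
      (else# refl (pop# refl ⨾# else# refl (pop# refl ⨾#
        variableGate-run (one A) (toℕ i) (m≤n⇒m≤1+n (toℕ<n i)) n≤K (<⇒≤ l<K) (≤ᵇ⇒≤ 5 7 tt)))) rest
    formula-run (var (inj₂ i)) n≤K l<K rest = token-loop refl ≤-refl
      (else# refl (pop# refl ⨾# then# refl (pop# refl ⨾#
        variableGate-run (N ⊕ A) (toℕ i) (m≤n⇒m≤1+n (toℕ<n i)) n≤K (<⇒≤ l<K) (≤ᵇ⇒≤ 7 7 tt)))) rest
    formula-run (¬′ φ) n≤K l<K rest = formula-run φ n≤K (<⇒≤ l<K)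
      (token-loop refl (≤ᵇ⇒≤ 10 20 tt)
        (then# refl (pop# refl ⨾# else# refl (pop# refl ⨾# negation-run n≤K (<⇒≤ l<K)))) rest)
    formula-run (φ ∧′ χ) {l = l} n≤K l<K rest =
      let l≤K = <⇒≤ l<K
          l₁≤K = ≤-trans (≤-last χ (last φ l)) l≤K
      in formula-run φ n≤K l₁≤K (formula-run χ n≤K l≤K (token-loop refl (≤ᵇ⇒≤ 17 20 tt)
        (then# refl (pop# refl ⨾# then# refl (pop# refl ⨾# else# refl (pop# refl ⨾#
          connectiveGate-run false (last φ l) n≤K l₁≤K l≤K)))) rest))
    formula-run (φ ∨′ χ) {l = l} n≤K l<K rest =
      let l≤K = <⇒≤ l<K
          l₁≤K = ≤-trans (≤-last χ (last φ l)) l≤K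
      in formula-run φ n≤K l₁≤K (formula-run χ n≤K l≤K (token-loop refl (≤ᵇ⇒≤ 17 20 tt)
        (then# refl (pop# refl ⨾# then# refl (pop# refl ⨾# then# refl (pop# refl ⨾#
          connectiveGate-run true (last φ l) n≤K l₁≤K l≤K)))) rest))

    footer-run : ∀ {o s} n l → suc n ≤ K → 2 + l ≤ K →
      footer ⊢ state [] o s 0 (suc n) l ⇒ state [] (payoffGates n l o) s 0 0 (1 + l) # n * 5 + 1 + 18
    footer-run {o} {s} n l n≤K l≤K =
      weaken# (≤-reflexive (+-comm 18 (n * 5 + 1))) (
        emit# (z≤n ∷ n≤K ∷ ≤-trans (m≤n+m l 2) l≤K ∷ []) (lit true ∷ lit false ∷ lit false ∷
          lit true ∷ lit true ∷ lit false ∷ lit false ∷ num (one L) ∷ []) ⨾#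
        push# ⨾# push# ⨾#
        emit# (z≤n ∷ n≤K ∷ l≤K ∷ []) (lit false ∷ num (one L) ∷ []) ⨾#
        pop# refl ⨾# pop# refl ⨾#
        countdown# n (λ w d → state [] (copies (1 + l) d o₃) s 0 w (1 + l)) (λ _ _ → refl) (λ _ → refl)
          (λ w d eq → pop# refl ⨾#
             emit# (z≤n ∷ ≤-trans (remaining≤ eq) (<⇒≤ n≤K) ∷ <⇒≤ l≤K ∷ []) (num (one L) ∷ [])))
      where
      o₃ = unary (2 + l) ʳ++ (false ∷ binaryGate false 0 l (notGate 0 o))

    loopCost-size : ∀ (φ : Formula (Variables n)) c → loopCost φ c ≡ size φ * 21 + c
    loopCost-size₂ : ∀ (φ χ : Formula (Variables n)) c →
      loopCost φ (loopCost χ (21 + c)) ≡ suc (size φ + size χ) * 21 + c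
    loopCost-size (var _)  c = refl
    loopCost-size (¬′ φ)   c = trans (loopCost-size φ (21 + c))
      (solve 2 (λ s c → s :* con 21 :+ (con 21 :+ c) := (con 1 :+ s) :* con 21 :+ c) refl (size φ) c)
      where open +-*-Solver
    loopCost-size (φ ∧′ χ) c = loopCost-size₂ φ χ c
    loopCost-size (φ ∨′ χ) c = loopCost-size₂ φ χ c
    loopCost-size₂ φ χ c =
      trans (loopCost-size φ _) (trans (cong (size φ * 21 +_) (loopCost-size χ (21 + c)))
      (solve 3 (λ s t c → s :* con 21 :+ (t :* con 21 :+ (con 21 :+ c))
                       := (con 1 :+ (s :+ t)) :* con 21 :+ c) refl (size φ) (size χ) c))
      where open +-*-Solver

  suc-+-≤ : ∀ s {x y} → x < y → suc (s + x) ≤ s + y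
  suc-+-≤ s {x} x<y = ≤-trans (≤-reflexive (sym (+-suc s x))) (+-monoʳ-≤ s x<y)

  -- Every subformula has a token of its own. By `last-size` and `loopCost-size`, this bounds both
  -- the wires and the time in terms of the input length.
  size≤tokens : ∀ (φ : Formula (Variables n)) r → size φ + length r ≤ length (tokens φ r)
  size≤tokens₂ : ∀ (φ χ : Formula (Variables n)) β r →
    suc (size φ + size χ) + length r ≤ length (tokens φ (tokens χ (true ∷ true ∷ β ∷ r)))
  size≤tokens (var (inj₁ i)) r = s≤s (m≤n⇒m≤1+n (length-suffix (unary (toℕ i)) r))
  size≤tokens (var (inj₂ i)) r = s≤s (m≤n⇒m≤1+n (length-suffix (unary (toℕ i)) r))
  size≤tokens (¬′ φ)   r = ≤-trans (suc-+-≤ (size φ) (n≤1+n (suc (length r)))) (size≤tokens φ _)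
  size≤tokens (φ ∧′ χ) r = size≤tokens₂ φ χ false r
  size≤tokens (φ ∨′ χ) r = size≤tokens₂ φ χ true r
  size≤tokens₂ φ χ β r = begin
    suc (size φ + size χ + length r)   ≡⟨ cong suc (+-assoc (size φ) (size χ) (length r)) ⟩
    suc (size φ + (size χ + length r)) ≤⟨ suc-+-≤ (size φ) (suc-+-≤ (size χ) (m≤n+m (suc (length r)) 2)) ⟩
    size φ + (size χ + (3 + length r)) ≤⟨ +-monoʳ-≤ (size φ) (size≤tokens χ _) ⟩
    size φ + length (tokens χ (true ∷ true ∷ β ∷ r)) ≤⟨ size≤tokens φ _ ⟩
    length (tokens φ (tokens χ (true ∷ true ∷ β ∷ r))) ∎
    where open ≤-Reasoning

  1≤size : ∀ (φ : Formula (Variables n)) → 1 ≤ size φ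
  1≤size (var _)  = s≤s z≤n
  1≤size (¬′ _)   = s≤s z≤n
  1≤size (_ ∧′ _) = s≤s z≤n
  1≤size (_ ∨′ _) = s≤s z≤n

  program-run : ∀ n (ψ : Formula (Variables n)) →
    let w = unary n ++ tokens ψ [] ; l = last ψ (n + suc n)
        K = 2 * suc (length w) in
    ∃[ σ ] Units._⊢_⇒_#_ K program ⟨ w , [] , [] ∣ 0 ∷ 0 ∷ 0 ∷ [] ⟩
      ([] ∷ payoffGates n l (gates ψ (n + suc n) (unary (suc n) ʳ++ [])) ∷ σ) (26 * suc (length w))
  program-run n ψ = _ , weaken# cost
    (header-run K n ⨾#
     formula-run K ψ (≤-trans n≤l (≤-trans (m≤n+m l 2) l≤K)) (≤-trans (m≤n+m l 2) l≤K) (exit# refl) ⨾#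
     footer-run K n l (≤-trans n≤l (≤-trans (m≤n+m l 2) l≤K)) l≤K)
    where
    s = size ψ
    p = length (tokens ψ [])
    l = last ψ (n + suc n)
    ℓ = length (unary n ++ tokens ψ [])
    K = 2 * suc ℓ
    open Units K
    s≤p : s ≤ p
    s≤p = subst (_≤ p) (+-identityʳ s) (size≤tokens ψ [])
    n≤l : suc n ≤ l
    n≤l = ≤-trans (m≤n+m (suc n) n) (≤-last ψ (n + suc n))
    open +-*-Solver
    open ≤-Reasoning
    l≤K : 2 + l ≤ K
    l≤K = begin
      2 + l                    ≡⟨ cong (2 +_) (last-size ψ (n + suc n)) ⟩
      2 + (s + (n + suc n))    ≡⟨ solve 2 (λ s n → con 2 :+ (s :+ (n :+ (con 1 :+ n)))
                                                := con 2 :* (con 1 :+ n) :+ (con 1 :+ s)) refl s n ⟩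
      2 * suc n + (1 + s)      ≤⟨ +-monoʳ-≤ (2 * suc n) (+-mono-≤ (≤-trans (1≤size ψ) s≤p) s≤p) ⟩
      2 * suc n + (p + p)      ≡⟨ solve 2 (λ n p → con 2 :* (con 1 :+ n) :+ (p :+ p)
                                                := con 2 :* (con 1 :+ n :+ p)) refl n p ⟩
      2 * (suc n + p)          ≡⟨ cong (2 *_) (length-unary n (tokens ψ [])) ⟨
      2 * ℓ                    ≤⟨ *-monoʳ-≤ 2 (n≤1+n ℓ) ⟩
      K                        ∎
    -- The constant terms add up to 26, which exceeds the coefficients 11 of n and 21 of p.
    cost : n * 6 + 6 + (loopCost K ψ 1 + (n * 5 + 1 + 18)) ≤ 26 * suc ℓ
    cost = begin
      n * 6 + 6 + (loopCost K ψ 1 + (n * 5 + 1 + 18))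
        ≡⟨ cong (λ c → n * 6 + 6 + (c + (n * 5 + 1 + 18))) (loopCost-size K ψ 1) ⟩
      n * 6 + 6 + (s * 21 + 1 + (n * 5 + 1 + 18))
        ≤⟨ +-monoʳ-≤ (n * 6 + 6) (+-monoˡ-≤ (n * 5 + 1 + 18) (+-monoˡ-≤ 1 (*-monoˡ-≤ 21 s≤p))) ⟩
      n * 6 + 6 + (p * 21 + 1 + (n * 5 + 1 + 18))
        ≤⟨ m≤m+n _ (n * 15 + p * 5 + 26) ⟩
      n * 6 + 6 + (p * 21 + 1 + (n * 5 + 1 + 18)) + (n * 15 + p * 5 + 26)
        ≡⟨ solve 2 (λ n p → n :* con 6 :+ con 6 :+ (p :* con 21 :+ con 1 :+ (n :* con 5 :+ con 1 :+ con 18))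
                              :+ (n :* con 15 :+ p :* con 5 :+ con 26)
                         := con 26 :* (con 2 :+ n :+ p)) refl n p ⟩
      26 * suc (suc n + p)
        ≡⟨ cong (λ x → 26 * suc x) (length-unary n (tokens ψ [])) ⟨
      26 * suc ℓ ∎

U∃∀-Sat≤WDom : U∃∀-Sat ≤ₚ WDom-Strategy
U∃∀-Sat≤WDom =
  game , polynomialTime {P = U∃∀-Sat} {Q = WDom-Strategy} {f = game} ToGame.program 26 (λ (n , ψ) → run n ψ) ,
  λ (n , ψ) → game-correct n ψ
  where
  game : Instance U∃∀-Sat → Instance WDom-Strategy
  game (n , ψ) = suc n , gameCircuit n ψ
  run : ∀ n (ψ : Formula (Variables n)) →
    let w = encode U∃∀-Sat (n , ψ)
        v = encode WDom-Strategy (suc n , gameCircuit n ψ) in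
    ∃[ σ ] Units._⊢_⇒_#_ (2 * suc (length w)) ToGame.program ⟨ w , [] , [] ∣ 0 ∷ 0 ∷ 0 ∷ [] ⟩
      ([] ∷ (v ʳ++ []) ∷ σ) (26 * suc (length w))
  run n ψ = subst₂ (λ w o → ∃[ σ ] Units._⊢_⇒_#_ (2 * suc (length w)) ToGame.program
                                     ⟨ w , [] , [] ∣ 0 ∷ 0 ∷ 0 ∷ [] ⟩ ([] ∷ o ∷ σ) (26 * suc (length w)))
    (cong (unary n ++_) (trans (sym (tokens-encode ψ [])) (++-identityʳ (encodeFormula ψ))))
    (sym (game-encode n ψ))
    (ToGame.program-run n ψ)

-- From games to formulas

Raw : Set
Raw = Formula (ℕ ⊎ ℕ)

pattern X i = var (inj₁ i)
pattern Y i = var (inj₂ i)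

differ : {V : Set} → Formula V → Formula V → Formula V
differ φ χ = (φ ∧′ ¬′ χ) ∨′ (¬′ φ ∧′ χ)

-- A substitute for constants, which formulas lack. Variable 0 always exists, as there are 2ℓ + 1
-- variables of each kind.
truth falsity : Raw
truth   = Y 0 ∨′ ¬′ Y 0
falsity = Y 0 ∧′ ¬′ Y 0

-- In all uses the accumulator is the left operand, hence comes first in postfix, so that each round
-- of a loop only appends to the output.
range : (Raw → ℕ → Raw) → Raw → ℕ → Raw
range f acc zero    = acc
range f acc (suc k) = f (range f acc k) k

gateFormula : (ℕ → ℕ) → Gate m → Raw
gateFormula copy (NOT i)   = ¬′ Y (copy (toℕ i))
gateFormula copy (AND i j) = Y (copy (toℕ i)) ∧′ Y (copy (toℕ j))
gateFormula copy (OR i j)  = Y (copy (toℕ i)) ∨′ Y (copy (toℕ j))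

fault : (ℕ → ℕ) → Gate m → Raw
fault {m} copy g = differ (Y (copy m)) (gateFormula copy g)

-- y_w is the value of wire w of C(x‖y), and y_{ℓ+w} that of C(x′‖y).
module Encoding (ℓ : ℕ) where

  -- Lexicographic comparison from the most significant bit on: either strictly greater here, or not
  -- smaller here and not smaller in the rest.
  geq : Vec (Fin m) k → Raw
  geq []       = truth
  geq (o ∷ os) = (Y (toℕ o) ∧′ ¬′ Y (ℓ + toℕ o)) ∨′ (Y (toℕ o) ∨′ ¬′ Y (ℓ + toℕ o)) ∧′ geq os

  addFaults : Raw → Gate m → Raw
  addFaults acc g = (acc ∨′ fault id g) ∨′ fault (ℓ +_) g

  simulation : Raw → Circuit m k → Raw
  simulation acc (outputs os) = acc ∨′ geq os
  simulation acc (gate g C)   = simulation (addFaults acc g) C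

  strategyFault sharedFault padding : ℕ → Raw → ℕ → Raw
  strategyFault _ acc i = acc ∨′ differ (Y i) (X i)
  sharedFault   n acc i = acc ∨′ differ (Y (i + n)) (Y (ℓ + (i + n)))
  padding       n acc i = acc ∧′ X (i + n)

  inputFaults : ℕ → Raw
  inputFaults n = range (sharedFault n) (range (strategyFault n) falsity n) n

  paddings : ℕ → ℕ → Raw
  paddings n r = range (padding n) truth r

  -- A y that is not the computation of both payoffs contains a fault and
  -- satisfies the simulation. The x_i with i ≥ n are forced to be true, so that
  -- x is determined by the strategy x_0 … x_{n-1}.
  dominanceFormula : ∀ n → Circuit (n + n) n → ℕ → Raw
  dominanceFormula n C r = paddings n r ∧′ simulation (inputFaults n) C

nth : Bool → Vec Bool n → ℕ → Bool
nth d []      _       = d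
nth d (b ∷ v) zero    = b
nth d (b ∷ v) (suc i) = nth d v i

nth-toℕ : ∀ d (v : Vec Bool n) i → nth d v (toℕ i) ≡ lookup v i
nth-toℕ d (b ∷ v) zero    = refl
nth-toℕ d (b ∷ v) (suc i) = nth-toℕ d v i

nth-beyond : ∀ d (v : Vec Bool n) {i} → n ≤ i → nth d v i ≡ d
nth-beyond d []      _         = refl
nth-beyond d (_ ∷ v) (s≤s n≤i) = nth-beyond d v n≤i

prefix : ∀ n → (ℕ → Bool) → Vec Bool n
prefix n f = tabulate (f ∘ toℕ)

nth-prefix : ∀ d f {i} → i < n → nth d (prefix n f) i ≡ f i
nth-prefix d f {zero}  (s≤s _)   = refl
nth-prefix d f {suc i} (s≤s i<n) = nth-prefix d (f ∘ suc) i<n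

prefix-‼ : ∀ f {i} → i ≤ n → prefix (suc n) f ‼ i ≡ f i
prefix-‼ f i≤n = trans (lookup∘tabulate (f ∘ toℕ) (clamp _)) (cong f (toℕ-clamp i≤n))

‼-ext : ∀ {v w : Vec Bool (suc n)} → (∀ i → i ≤ n → v ‼ i ≡ w ‼ i) → v ≡ w
‼-ext {n} {v} {w} eq = begin
  v                   ≡⟨ tabulate∘lookup v ⟨
  tabulate (lookup v) ≡⟨ tabulate-cong same ⟩
  tabulate (lookup w) ≡⟨ tabulate∘lookup w ⟩
  w                   ∎
  where
  open ≡-Reasoning
  same : ∀ i → lookup v i ≡ lookup w i
  same i = subst (λ j → lookup v j ≡ lookup w j) (clamp-toℕ i) (eq (toℕ i) (toℕ≤pred[n] i))

record Agrees (η : ℕ → Bool) (v : Vec Bool n) : Set where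
  constructor agrees
  field at : ∀ i → η (toℕ i) ≡ lookup v i

open Agrees

agrees-tail : ∀ {η b} {v : Vec Bool n} → Agrees η (b ∷ v) → Agrees (η ∘ suc) v
agrees-tail agr = agrees (at agr ∘ suc)

agrees-∷ : ∀ {η b} {v : Vec Bool n} → η 0 ≡ b → Agrees (η ∘ suc) v → Agrees η (b ∷ v)
agrees-∷ eq agr = agrees λ { zero → eq ; (suc i) → at agr i }

agrees-∷ʳ : ∀ {η} (v : Vec Bool n) {b} → Agrees η v → η n ≡ b → Agrees η (v ∷ʳ b)
agrees-∷ʳ []      _   eq = agrees-∷ eq (agrees λ ())
agrees-∷ʳ (_ ∷ v) agr eq = agrees-∷ (at agr zero) (agrees-∷ʳ v (agrees-tail agr) eq)

agrees-init : ∀ {η} (v : Vec Bool n) {b} → Agrees η (v ∷ʳ b) → Agrees η v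
agrees-init []      _   = agrees λ ()
agrees-init (_ ∷ v) agr = agrees-∷ (at agr zero) (agrees-init v (agrees-tail agr))

agrees-last : ∀ {η} (v : Vec Bool n) {b} → Agrees η (v ∷ʳ b) → η n ≡ b
agrees-last []      agr = at agr zero
agrees-last (_ ∷ v) agr = agrees-last v (agrees-tail agr)

agrees-++ : ∀ {η} (v : Vec Bool m) (w : Vec Bool n) → Agrees η v → Agrees (η ∘ (m +_)) w →
            Agrees η (v Vec.++ w)
agrees-++ []      w _    agr′ = agr′
agrees-++ (_ ∷ v) w agr agr′ = agrees-∷ (at agr zero) (agrees-++ v w (agrees-tail agr) agr′)

agrees-++ˡ : ∀ {η} (v : Vec Bool m) (w : Vec Bool n) → Agrees η (v Vec.++ w) → Agrees η v
agrees-++ˡ []      w _   = agrees λ ()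
agrees-++ˡ (_ ∷ v) w agr = agrees-∷ (at agr zero) (agrees-++ˡ v w (agrees-tail agr))

agrees-++ʳ : ∀ {η} (v : Vec Bool m) (w : Vec Bool n) → Agrees η (v Vec.++ w) → Agrees (η ∘ (m +_)) w
agrees-++ʳ []      w agr = agr
agrees-++ʳ (_ ∷ v) w agr = agrees-++ʳ v w (agrees-tail agr)

agrees-prefix : ∀ f → Agrees f (prefix n f)
agrees-prefix f = agrees λ i → sym (lookup∘tabulate (f ∘ toℕ) i)

wireCount : Circuit m k → ℕ
wireCount {m} (outputs _) = m
wireCount     (gate _ C)  = wireCount C

≤-wireCount : (C : Circuit m k) → m ≤ wireCount C
≤-wireCount (outputs _) = ≤-refl
≤-wireCount (gate _ C)  = <⇒≤ (≤-wireCount C)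

-- The honest computation, used to fill in the universal variables without any fault.
wires : (C : Circuit m k) → Vec Bool m → Vec Bool (wireCount C)
wires (outputs _) v = v
wires (gate g C)  v = wires C (v ∷ʳ evalGate g v)

agrees-wires : ∀ {η} (C : Circuit m k) v → Agrees η (wires C v) → Agrees η v
agrees-wires (outputs _) v agr = agr
agrees-wires (gate g C)  v agr = agrees-init v (agrees-wires C _ agr)

-- A leading 1 outweighs all later bits, which is why lexicographic order is the order of values.
value<2^n : (v : Vec Bool n) → value v < 2 ^ n
value<2^n []          = s≤s z≤n
value<2^n (false ∷ v) = ≤-trans (value<2^n v) (m≤m+n _ _)
value<2^n {suc n} (true ∷ v) = begin-strict
  1 * 2 ^ n + value v <⟨ +-monoʳ-< (1 * 2 ^ n) (value<2^n v) ⟩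
  1 * 2 ^ n + 2 ^ n   ≡⟨ +-comm (1 * 2 ^ n) (2 ^ n) ⟩
  2 ^ n + 1 * 2 ^ n   ∎
  where open ≤-Reasoning

module Semantics (ℓ : ℕ) (ξ η : ℕ → Bool) where
  open Encoding ℓ

  ⟦_⟧ : Raw → Bool
  ⟦_⟧ = eval [ ξ , η ]

  ∨-split : ∀ {a b} → a ∨ b ≡ true → a ≡ true ⊎ b ≡ true
  ∨-split {true}  _  = inj₁ refl
  ∨-split {false} eq = inj₂ eq

  ∨-left : ∀ {a} b → a ≡ true → a ∨ b ≡ true
  ∨-left b refl = refl

  ∨-right : ∀ a {b} → b ≡ true → a ∨ b ≡ true
  ∨-right true  _  = refl
  ∨-right false eq = eq

  ∧-split : ∀ {a b} → a ∧ b ≡ true → a ≡ true × b ≡ true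
  ∧-split {true} eq = refl , eq

  ⟦truth⟧ : ⟦ truth ⟧ ≡ true
  ⟦truth⟧ with η 0
  ... | true  = refl
  ... | false = refl

  ⟦falsity⟧ : ⟦ falsity ⟧ ≡ false
  ⟦falsity⟧ with η 0
  ... | true  = refl
  ... | false = refl

  differ-or-equal : ∀ φ χ → ⟦ differ φ χ ⟧ ≡ true ⊎ ⟦ φ ⟧ ≡ ⟦ χ ⟧
  differ-or-equal φ χ with ⟦ φ ⟧ | ⟦ χ ⟧
  ... | true  | true  = inj₂ refl
  ... | true  | false = inj₁ refl
  ... | false | true  = inj₁ refl
  ... | false | false = inj₂ refl

  equal⇒¬differ : ∀ φ χ → ⟦ φ ⟧ ≡ ⟦ χ ⟧ → ⟦ differ φ χ ⟧ ≡ false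
  equal⇒¬differ φ χ eq with ⟦ φ ⟧ | ⟦ χ ⟧ | eq
  ... | true  | .true  | refl = refl
  ... | false | .false | refl = refl

  range-∧ : ∀ (f : ℕ → Raw) acc r → ⟦ range (λ acc i → acc ∧′ f i) acc r ⟧ ≡ true →
            ∀ i → i < r → ⟦ f i ⟧ ≡ true
  range-∧ f acc (suc r) eq i i<r with m<1+n⇒m<n∨m≡n i<r
  ... | inj₁ i<r′ = range-∧ f acc r (proj₁ (∧-split eq)) i i<r′
  ... | inj₂ refl = proj₂ (∧-split eq)

  range-∧-true : ∀ (f : ℕ → Raw) acc r → ⟦ acc ⟧ ≡ true → (∀ i → i < r → ⟦ f i ⟧ ≡ true) →
                 ⟦ range (λ acc i → acc ∧′ f i) acc r ⟧ ≡ true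
  range-∧-true f acc zero    eq _   = eq
  range-∧-true f acc (suc r) eq all =
    cong₂ _∧_ (range-∧-true f acc r eq (λ i i<r → all i (m<n⇒m<1+n i<r))) (all r ≤-refl)

  range-∨ : ∀ (f : ℕ → Raw) acc r → ⟦ range (λ acc i → acc ∨′ f i) acc r ⟧ ≡ false →
            ⟦ acc ⟧ ≡ false × (∀ i → i < r → ⟦ f i ⟧ ≡ false)
  range-∨ f acc zero    eq = eq , λ _ ()
  range-∨ f acc (suc r) eq with ⟦ range (λ acc i → acc ∨′ f i) acc r ⟧ in eq₁
  ... | false with range-∨ f acc r eq₁
  ...   | acc-false , all = acc-false , λ i i<r → [ all i , (λ { refl → eq }) ] (m<1+n⇒m<n∨m≡n i<r)

  range-∨-false : ∀ (f : ℕ → Raw) acc r → ⟦ acc ⟧ ≡ false → (∀ i → i < r → ⟦ f i ⟧ ≡ false) →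
                  ⟦ range (λ acc i → acc ∨′ f i) acc r ⟧ ≡ false
  range-∨-false f acc zero    eq _   = eq
  range-∨-false f acc (suc r) eq all =
    cong₂ _∨_ (range-∨-false f acc r eq (λ i i<r → all i (m<n⇒m<1+n i<r))) (all r ≤-refl)

  gateFormula-value : ∀ copy (g : Gate m) {v} → Agrees (η ∘ copy) v → ⟦ gateFormula copy g ⟧ ≡ evalGate g v
  gateFormula-value copy (NOT i)   agr = cong not (at agr i)
  gateFormula-value copy (AND i j) agr = cong₂ _∧_ (at agr i) (at agr j)
  gateFormula-value copy (OR i j)  agr = cong₂ _∨_ (at agr i) (at agr j)

  module _ {m} {v₁ v₂ : Vec Bool m} (agr₁ : Agrees η v₁) (agr₂ : Agrees (η ∘ (ℓ +_)) v₂) where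

    geq-sound : ∀ (os : Vec (Fin m) k) → ⟦ geq os ⟧ ≡ true →
                value (Vec.map (lookup v₁) os) ≥ value (Vec.map (lookup v₂) os)
    geq-sound [] _ = z≤n
    geq-sound {suc k} (o ∷ os) eq rewrite at agr₁ o | at agr₂ o with lookup v₁ o | lookup v₂ o
    ... | true  | true  = +-monoʳ-≤ (1 * 2 ^ k) (geq-sound os eq)
    ... | false | false = geq-sound os eq
    ... | true  | false = ≤-trans (<⇒≤ (value<2^n (Vec.map (lookup v₂) os)))
                            (≤-trans (≤-reflexive (sym (*-identityˡ (2 ^ k)))) (m≤m+n _ _))

    geq-complete : ∀ (os : Vec (Fin m) k) →
                   value (Vec.map (lookup v₁) os) ≥ value (Vec.map (lookup v₂) os) → ⟦ geq os ⟧ ≡ true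
    geq-complete [] _ = ⟦truth⟧
    geq-complete {suc k} (o ∷ os) ge rewrite at agr₁ o | at agr₂ o with lookup v₁ o | lookup v₂ o
    ... | true  | true  = geq-complete os (+-cancelˡ-≤ (1 * 2 ^ k) _ _ ge)
    ... | false | false = geq-complete os ge
    ... | true  | false = refl
    ... | false | true  = ⊥-elim (<⇒≱ (value<2^n (Vec.map (lookup v₁) os))
                            (≤-trans (≤-trans (≤-reflexive (sym (*-identityˡ (2 ^ k)))) (m≤m+n _ _)) ge))

  simulation-mono : ∀ acc (C : Circuit m k) → ⟦ acc ⟧ ≡ true → ⟦ simulation acc C ⟧ ≡ true
  simulation-mono acc (outputs os) eq = ∨-left _ eq
  simulation-mono acc (gate g C)   eq = simulation-mono _ C (∨-left _ (∨-left _ eq))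

  -- At each gate, a wrong value in either copy is a fault and makes the formula true; otherwise
  -- both agreements extend by one wire. At the outputs, the true payoffs are compared.
  simulation-complete : ∀ acc (C : Circuit m k) {v₁ v₂} → Agrees η v₁ → Agrees (η ∘ (ℓ +_)) v₂ →
    value (evalCircuit C v₁) ≥ value (evalCircuit C v₂) → ⟦ simulation acc C ⟧ ≡ true
  simulation-complete acc (outputs os) agr₁ agr₂ ge = ∨-right ⟦ acc ⟧ (geq-complete agr₁ agr₂ os ge)
  simulation-complete {m} acc (gate g C) {v₁} {v₂} agr₁ agr₂ ge
    with differ-or-equal (Y m) (gateFormula id g) | differ-or-equal (Y (ℓ + m)) (gateFormula (ℓ +_) g)
  ... | inj₁ faulty | _           = simulation-mono _ C (∨-left _ (∨-right ⟦ acc ⟧ faulty))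
  ... | _           | inj₁ faulty = simulation-mono _ C (∨-right (⟦ acc ⟧ ∨ _) faulty)
  ... | inj₂ eq₁    | inj₂ eq₂    = simulation-complete _ C
    (agrees-∷ʳ v₁ agr₁ (trans eq₁ (gateFormula-value id g agr₁)))
    (agrees-∷ʳ v₂ agr₂ (trans eq₂ (gateFormula-value (ℓ +_) g agr₂))) ge

  -- Along honest computations no gate contributes a fault, so the accumulated disjunction stays
  -- false and the comparison has to hold.
  simulation-sound : ∀ acc (C : Circuit m k) {v₁ v₂} →
    Agrees η (wires C v₁) → Agrees (η ∘ (ℓ +_)) (wires C v₂) →
    ⟦ acc ⟧ ≡ false → ⟦ simulation acc C ⟧ ≡ true →
    value (evalCircuit C v₁) ≥ value (evalCircuit C v₂)
  simulation-sound acc (outputs os) agr₁ agr₂ none eq with ∨-split {⟦ acc ⟧} eq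
  ... | inj₂ ge = geq-sound agr₁ agr₂ os ge
  ... | inj₁ some with () ← trans (sym none) some
  simulation-sound {m} acc (gate g C) {v₁} {v₂} agr₁ agr₂ none eq =
    simulation-sound _ C agr₁ agr₂
      (cong₂ _∨_ (cong₂ _∨_ none (correct id v₁ (agrees-wires C _ agr₁)))
                 (correct (ℓ +_) v₂ (agrees-wires C _ agr₂))) eq
    where
    correct : ∀ copy v → Agrees (η ∘ copy) (v ∷ʳ evalGate g v) → ⟦ fault copy g ⟧ ≡ false
    correct copy v agr = equal⇒¬differ (Y (copy m)) (gateFormula copy g)
      (trans (agrees-last v agr) (sym (gateFormula-value copy g (agrees-init v agr))))

scope : Raw → Formula (Fin (suc n) ⊎ Fin (suc n))
scope (X i)    = var (inj₁ (clamp i))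
scope (Y i)    = var (inj₂ (clamp i))
scope (¬′ φ)   = ¬′ scope φ
scope (φ ∧′ χ) = scope φ ∧′ scope χ
scope (φ ∨′ χ) = scope φ ∨′ scope χ

eval-scope : ∀ (x y : Vec Bool (suc n)) φ →
  eval [ lookup x , lookup y ] (scope φ) ≡ eval [ x ‼_ , y ‼_ ] φ
eval-scope x y (X i)    = refl
eval-scope x y (Y i)    = refl
eval-scope x y (¬′ φ)   = cong not (eval-scope x y φ)
eval-scope x y (φ ∧′ χ) = cong₂ _∧_ (eval-scope x y φ) (eval-scope x y χ)
eval-scope x y (φ ∨′ χ) = cong₂ _∨_ (eval-scope x y φ) (eval-scope x y χ)

agrees-nth : ∀ d {η} (v : Vec Bool n) {i} → Agrees η v → i < n → η i ≡ nth d v i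
agrees-nth d (_ ∷ _) {zero}  agr _         = at agr zero
agrees-nth d (_ ∷ v) {suc i} agr (s≤s i<n) = agrees-nth d v (agrees-tail agr) i<n

splice : ℕ → (ℕ → Bool) → (ℕ → Bool) → ℕ → Bool
splice zero    f g i       = g i
splice (suc ℓ) f g zero    = f zero
splice (suc ℓ) f g (suc i) = splice ℓ (f ∘ suc) g i

splice-< : ∀ ℓ f g {i} → i < ℓ → splice ℓ f g i ≡ f i
splice-< (suc ℓ) f g {zero}  _         = refl
splice-< (suc ℓ) f g {suc i} (s≤s i<ℓ) = splice-< ℓ (f ∘ suc) g i<ℓ

splice-+ : ∀ ℓ f g i → splice ℓ f g (ℓ + i) ≡ g i
splice-+ zero    f g i = refl
splice-+ (suc ℓ) f g i = splice-+ ℓ (f ∘ suc) g i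

≤-double : ∀ ℓ {i} → i ≤ ℓ → i ≤ ℓ * 2
≤-double ℓ i≤ℓ = ≤-trans i≤ℓ (m≤m*n ℓ 2)

+≤-double : ∀ ℓ {i} → i ≤ ℓ → ℓ + i ≤ ℓ * 2
+≤-double ℓ {i} i≤ℓ = begin
  ℓ + i ≤⟨ +-monoʳ-≤ ℓ i≤ℓ ⟩
  ℓ + ℓ ≡⟨ cong (ℓ +_) (+-identityʳ ℓ) ⟨
  2 * ℓ ≡⟨ *-comm 2 ℓ ⟩
  ℓ * 2 ∎
  where open ≤-Reasoning

-- Indices up to 2ℓ leave room for two copies of the wires. The first n of the x_i form the
-- strategy, the other r are padding.
module Dominance {n} (C : Circuit (n + n) n) {ℓ r}
  (wireCount≤ℓ : wireCount C ≤ ℓ) (r+n : r + n ≡ suc (ℓ * 2)) where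

  open Encoding ℓ

  ψ : Formula (Fin (suc (ℓ * 2)) ⊎ Fin (suc (ℓ * 2)))
  ψ = scope (dominanceFormula n C r)

  P : Vec Bool n → Vec Bool n → ℕ
  P x z = value (evalCircuit C (x Vec.++ z))

  VeryWeaklyDominant : Vec Bool n → Set
  VeryWeaklyDominant x = ∀ x′ z → P x z ≥ P x′ z

  Dominant : Vec Bool n → Set
  Dominant x = ∀ x′ y → x′ ≢ x → ∃[ y′ ] (P x y ≥ P x′ y × P x y′ > P x′ y′)

  Good : Vec Bool (suc (ℓ * 2)) → Set
  Good x = ∀ y → eval [ lookup x , lookup y ] ψ ≡ true

  Padded : Vec Bool (suc (ℓ * 2)) → Set
  Padded x = ∀ i → n ≤ i → i ≤ ℓ * 2 → x ‼ i ≡ true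

  strategy : Vec Bool (suc (ℓ * 2)) → Vec Bool n
  strategy x = prefix n (x ‼_)

  embed : Vec Bool n → Vec Bool (suc (ℓ * 2))
  embed x = prefix (suc (ℓ * 2)) (nth true x)

  n≤ℓ : n ≤ ℓ
  n≤ℓ = ≤-trans (m≤m+n n n) (≤-trans (≤-wireCount C) wireCount≤ℓ)

  good⇒true : ∀ x → Good x → ∀ y →
    let open Semantics ℓ (x ‼_) (y ‼_) in
    ⟦ paddings n r ⟧ ≡ true × ⟦ simulation (inputFaults n) C ⟧ ≡ true
  good⇒true x good y =
    Semantics.∧-split ℓ (x ‼_) (y ‼_) (trans (sym (eval-scope x y (dominanceFormula n C r))) (good y))

  good⇒padded : ∀ x → Good x → Padded x
  good⇒padded x good i n≤i i≤ = subst (λ j → x ‼ j ≡ true) (m∸n+n≡m n≤i)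
    (range-∧ (λ i → X (i + n)) truth r (proj₁ (good⇒true x good (Vec.replicate _ false))) (i ∸ n) i∸n<r)
    where
    open Semantics ℓ (x ‼_) (Vec.replicate _ false ‼_)
    i∸n<r : i ∸ n < r
    i∸n<r = +-cancelʳ-≤ n _ _ (subst₂ _≤_ (cong suc (sym (m∸n+n≡m n≤i))) (sym r+n) (s≤s i≤))

  good⇒veryWeaklyDominant : ∀ x → Good x → VeryWeaklyDominant (strategy x)
  good⇒veryWeaklyDominant x good x′ z =
    simulation-sound (inputFaults n) C agr₁ agr₂ noInputFaults (proj₂ (good⇒true x good y))
    where
    w₁ = wires C (strategy x Vec.++ z)
    w₂ = wires C (x′ Vec.++ z)
    -- The y without faults: the honest values for both payoffs, the second from index ℓ on. The
    -- default `false` fills the places that carry no wire.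
    f = splice ℓ (nth false w₁) (nth false w₂)
    y = prefix (suc (ℓ * 2)) f
    η = y ‼_
    open Semantics ℓ (x ‼_) η
    agr₁ : Agrees η w₁
    agr₁ = agrees λ i → let i<ℓ = ≤-trans (toℕ<n i) wireCount≤ℓ in
      trans (prefix-‼ f (≤-double ℓ (<⇒≤ i<ℓ)))
            (trans (splice-< ℓ (nth false w₁) _ i<ℓ) (nth-toℕ false w₁ i))
    agr₂ : Agrees (η ∘ (ℓ +_)) w₂
    agr₂ = agrees λ i →
      trans (prefix-‼ f (+≤-double ℓ (<⇒≤ (≤-trans (toℕ<n i) wireCount≤ℓ))))
            (trans (splice-+ ℓ (nth false w₁) _ (toℕ i)) (nth-toℕ false w₂ i))
    inputs₁ = agrees-wires C (strategy x Vec.++ z) agr₁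
    inputs₂ = agrees-wires C (x′ Vec.++ z) agr₂
    own : ∀ i → i < n → ⟦ differ (Y i) (X i) ⟧ ≡ false
    own i i<n = equal⇒¬differ (Y i) (X i)
      (trans (agrees-nth true (strategy x) (agrees-++ˡ (strategy x) z inputs₁) i<n)
             (nth-prefix true (x ‼_) i<n))
    shared : ∀ i → i < n → ⟦ differ (Y (i + n)) (Y (ℓ + (i + n))) ⟧ ≡ false
    shared i i<n = equal⇒¬differ (Y (i + n)) (Y (ℓ + (i + n)))
      (subst (λ j → η j ≡ η (ℓ + j)) (+-comm n i)
        (trans (agrees-nth true z (agrees-++ʳ (strategy x) z inputs₁) i<n)
               (sym (agrees-nth true z (agrees-++ʳ x′ z inputs₂) i<n))))
    noInputFaults : ⟦ inputFaults n ⟧ ≡ false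
    noInputFaults = range-∨-false (λ i → differ (Y (i + n)) (Y (ℓ + (i + n)))) _ n
      (range-∨-false (λ i → differ (Y i) (X i)) falsity n ⟦falsity⟧ own) shared

  veryWeaklyDominant⇒good : ∀ x → Padded x → VeryWeaklyDominant (strategy x) → Good x
  veryWeaklyDominant⇒good x padded dom y =
    trans (eval-scope x y (dominanceFormula n C r)) (cong₂ _∧_ pads (simulated (⟦ inputFaults n ⟧) refl))
    where
    η = y ‼_
    open Semantics ℓ (x ‼_) η
    pads : ⟦ paddings n r ⟧ ≡ true
    pads = range-∧-true (λ i → X (i + n)) truth r ⟦truth⟧
      (λ i i<r → padded (i + n) (m≤n+m n i) (s≤s⁻¹ (subst (suc (i + n) ≤_) r+n (+-monoˡ-≤ n i<r))))
    same : ∀ φ χ → ⟦ differ φ χ ⟧ ≡ false → ⟦ φ ⟧ ≡ ⟦ χ ⟧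
    same φ χ no-diff with differ-or-equal φ χ
    ... | inj₂ eq = eq
    ... | inj₁ diff with () ← trans (sym no-diff) diff
    -- The opponent and the rival strategy that `y` itself describes. In the absence of input
    -- faults, both simulated computations start from them.
    z  = prefix n (η ∘ (n +_))
    x′ = prefix n (η ∘ (ℓ +_))
    simulated : ∀ b → ⟦ inputFaults n ⟧ ≡ b → ⟦ simulation (inputFaults n) C ⟧ ≡ true
    simulated true  eq = simulation-mono (inputFaults n) C eq
    simulated false eq with range-∨ (λ i → differ (Y (i + n)) (Y (ℓ + (i + n)))) _ n eq
    ... | eq′ , shared with range-∨ (λ i → differ (Y i) (X i)) falsity n eq′
    ...   | _ , own = simulation-complete (inputFaults n) C
      (agrees-++ (strategy x) z
        (agrees λ i → trans (same (Y (toℕ i)) (X (toℕ i)) (own (toℕ i) (toℕ<n i)))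
                            (sym (lookup∘tabulate _ i)))
        (agrees-prefix (η ∘ (n +_))))
      (agrees-++ x′ z (agrees-prefix (η ∘ (ℓ +_)))
        (agrees λ i → trans (subst (λ j → η (ℓ + j) ≡ η j) (+-comm (toℕ i) n)
                              (sym (same (Y (toℕ i + n)) (Y (ℓ + (toℕ i + n))) (shared (toℕ i) (toℕ<n i)))))
                            (sym (lookup∘tabulate _ i))))
      (dom x′ z)

  strategy-embed : ∀ x → strategy (embed x) ≡ x
  strategy-embed x = trans (tabulate-cong λ i →
      trans (prefix-‼ (nth true x) (≤-double ℓ (<⇒≤ (≤-trans (toℕ<n i) n≤ℓ)))) (nth-toℕ true x i))
    (tabulate∘lookup x)

  padded-embed : ∀ x → Padded (embed x)
  padded-embed x i n≤i i≤ = trans (prefix-‼ (nth true x) i≤) (nth-beyond true x n≤i)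

  good-embed : ∀ {x} → VeryWeaklyDominant x → Good (embed x)
  good-embed {x} dom = veryWeaklyDominant⇒good (embed x) (padded-embed x)
    (subst VeryWeaklyDominant (sym (strategy-embed x)) dom)

  embed-strategy : ∀ x → Padded x → embed (strategy x) ≡ x
  embed-strategy x padded = ‼-ext λ i i≤ → trans (prefix-‼ (nth true (strategy x)) i≤) (agree i i≤)
    where
    agree : ∀ i → i ≤ ℓ * 2 → nth true (strategy x) i ≡ x ‼ i
    agree i i≤ with <-≤-connex i n
    ... | inj₁ i<n = nth-prefix true (x ‼_) i<n
    ... | inj₂ n≤i = trans (nth-beyond true (strategy x) n≤i) (sym (padded i n≤i i≤))

  dominant⇒veryWeaklyDominant : ∀ {x} → Dominant x → VeryWeaklyDominant x
  dominant⇒veryWeaklyDominant {x} dom x′ z with ≡-dec Bool._≟_ x′ x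
  ... | yes refl = ≤-refl
  ... | no x′≢x  = proj₁ (proj₂ (dom x′ z x′≢x))

  -- A very weakly dominant `x′` does at least as well as `x` against every opponent, which leaves
  -- no y′ where `x` is strictly better.
  dominant-unique : ∀ {x x′} → Dominant x → VeryWeaklyDominant x′ → x ≡ x′
  dominant-unique {x} {x′} dom dom′ with ≡-dec Bool._≟_ x′ x
  ... | yes x′≡x = sym x′≡x
  ... | no x′≢x with dom x′ x x′≢x
  ...   | y′ , _ , gt = ⊥-elim (<⇒≱ gt (dom′ x y′))

  -- A strategy x′ other than the unique very weakly dominant x is beaten by some
  -- strategy against some y′, hence also by x.
  unique⇒dominant : ∀ {x} → VeryWeaklyDominant x → (∀ {x′} → VeryWeaklyDominant x′ → x ≡ x′) → Dominant x
  unique⇒dominant {x} dom unique x′ y x′≢x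
    with search n (λ u → search n (λ z → ≤-<-connex (P u z) (P x′ z)))
  ... | inj₁ dom′            = ⊥-elim (x′≢x (sym (unique dom′)))
  ... | inj₂ (u , y′ , beats) = y′ , dom x′ y , <-≤-trans beats (dom u y′)

  dominance-correct : Yes WDom-Strategy (n , C) ⇔ Yes U∃∀-Sat (suc (ℓ * 2) , ψ)
  dominance-correct = mk⇔
    (λ { (x , dom) → embed x , good-embed (dominant⇒veryWeaklyDominant dom) ,
           λ {x′} good → trans (cong embed (dominant-unique dom (good⇒veryWeaklyDominant x′ good)))
                          (embed-strategy x′ (good⇒padded x′ good)) })
    (λ { (x , good , unique) → strategy x ,
           unique⇒dominant (good⇒veryWeaklyDominant x good)
             (λ {x′} dom′ → trans (cong strategy (unique {embed x′} (good-embed dom′))) (strategy-embed x′)) })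

-- The dominance formula as a word

-- Accumulated in reverse, like gates.
code : Raw → Word → Word
code (X i)    o = unary i ʳ++ (false ∷ false ∷ o)
code (Y i)    o = unary i ʳ++ (true ∷ false ∷ o)
code (¬′ φ)   o = false ∷ true ∷ code φ o
code (φ ∧′ χ) o = false ∷ true ∷ true ∷ code χ (code φ o)
code (φ ∨′ χ) o = true ∷ true ∷ true ∷ code χ (code φ o)

-- Under this bound clamping changes nothing, so the indices in the encoding are the very numbers
-- that the machine writes.
Below : ℕ → Raw → Set
Below n (X i)    = i ≤ n
Below n (Y i)    = i ≤ n
Below n (¬′ φ)   = Below n φ
Below n (φ ∧′ χ) = Below n φ × Below n χ
Below n (φ ∨′ χ) = Below n φ × Below n χ

tokens-code : ∀ φ r o → Below n φ → tokens (scope {n} φ) r ʳ++ o ≡ r ʳ++ code φ o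
tokens-code (X i) r o i≤n rewrite unary-clamp i≤n = ++-ʳ++ (false ∷ false ∷ unary i)
tokens-code (Y i) r o i≤n rewrite unary-clamp i≤n = ++-ʳ++ (false ∷ true ∷ unary i)
tokens-code (¬′ φ)   r o b       = tokens-code φ _ o b
tokens-code (φ ∧′ χ) r o (b , c) = trans (tokens-code φ _ o b) (tokens-code χ _ _ c)
tokens-code (φ ∨′ χ) r o (b , c) = trans (tokens-code φ _ o b) (tokens-code χ _ _ c)

encode-code : ∀ φ o → Below n φ → encodeFormula (scope {n} φ) ʳ++ o ≡ code φ o
encode-code {n} φ o b =
  trans (cong (_ʳ++ o) (trans (sym (++-identityʳ _)) (tokens-encode (scope {n} φ) [])))
        (tokens-code φ [] o b)

below-range : ∀ {f : Raw → ℕ → Raw} {acc} r → Below n acc →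
  (∀ {acc} i → i < r → Below n acc → Below n (f acc i)) → Below n (range f acc r)
below-range zero    b _    = b
below-range (suc r) b step = step r ≤-refl (below-range r b (λ i i<r → step i (m<n⇒m<1+n i<r)))

below-fault : ∀ copy (g : Gate m) → (∀ i → i ≤ m → copy i ≤ n) → Below n (fault copy g)
below-fault {m} {n} copy g b = (b m ≤-refl , operands g) , (b m ≤-refl , operands g)
  where
  operands : ∀ g → Below n (gateFormula {m} copy g)
  operands (NOT i)   = b _ (<⇒≤ (toℕ<n i))
  operands (AND i j) = b _ (<⇒≤ (toℕ<n i)) , b _ (<⇒≤ (toℕ<n j))
  operands (OR i j)  = b _ (<⇒≤ (toℕ<n i)) , b _ (<⇒≤ (toℕ<n j))

module _ (ℓ : ℕ) where
  open Encoding ℓ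

  below-geq : ∀ (os : Vec (Fin m) k) → m ≤ ℓ → Below (ℓ * 2) (geq os)
  below-geq []       _   = z≤n , z≤n
  below-geq (i ∷ os) m≤ℓ = (own , other) , (own , other) , below-geq os m≤ℓ
    where
    i≤ℓ   = ≤-trans (<⇒≤ (toℕ<n i)) m≤ℓ
    own   = ≤-double ℓ i≤ℓ
    other = +≤-double ℓ i≤ℓ

  below-simulation : ∀ {acc} (C : Circuit m k) → wireCount C ≤ ℓ → Below (ℓ * 2) acc →
                     Below (ℓ * 2) (simulation acc C)
  below-simulation (outputs os) w≤ℓ b = b , below-geq os w≤ℓ
  below-simulation (gate g C)   w≤ℓ b = below-simulation C w≤ℓ
    ((b , below-fault id g (λ i i≤m → ≤-double ℓ (≤-trans i≤m m≤ℓ))) ,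
     below-fault (ℓ +_) g (λ i i≤m → +≤-double ℓ (≤-trans i≤m m≤ℓ)))
    where m≤ℓ = <⇒≤ (≤-trans (≤-wireCount C) w≤ℓ)

  below-dominanceFormula : ∀ (C : Circuit (n + n) n) r → wireCount C ≤ ℓ → r + n ≡ suc (ℓ * 2) →
                           Below (ℓ * 2) (dominanceFormula n C r)
  below-dominanceFormula {n} C r w≤ℓ r+n =
    below-range r (z≤n , z≤n) (λ i i<r b → b , s≤s⁻¹ (subst (suc (i + n) ≤_) r+n (+-monoˡ-≤ n i<r))) ,
    below-simulation C w≤ℓ
      (below-range n
        (below-range n (z≤n , z≤n)
          (λ i i<n b → b , ((own i i<n , own i i<n) , (own i i<n , own i i<n))))
        (λ i i<n b → b , ((≤-double ℓ (shared i i<n) , +≤-double ℓ (shared i i<n)) ,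
                          (≤-double ℓ (shared i i<n) , +≤-double ℓ (shared i i<n)))))
    where
    shared : ∀ i → i < n → i + n ≤ ℓ
    shared i i<n = ≤-trans (+-monoˡ-≤ n (<⇒≤ i<n)) (≤-trans (≤-wireCount C) w≤ℓ)
    own : ∀ i → i < n → i ≤ ℓ * 2
    own i i<n = ≤-double ℓ (≤-trans (m≤m+n i n) (shared i i<n))

-- A formula whose variables name registers is a template. Its items are in postfix order, so
-- emitting a concrete template extends the output as `code` does, by mere computation.
items : Formula (Index m ⊎ Index m) → List (Item m) → List (Item m)
items (X ι)    xs = lit false ∷ lit false ∷ num ι ∷ xs
items (Y ι)    xs = lit false ∷ lit true ∷ num ι ∷ xs
items (¬′ φ)   xs = items φ (lit true ∷ lit false ∷ xs)
items (φ ∧′ χ) xs = items φ (items χ (lit true ∷ lit true ∷ lit false ∷ xs))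
items (φ ∨′ χ) xs = items φ (items χ (lit true ∷ lit true ∷ lit true ∷ xs))

gateCount : Circuit m k → ℕ
gateCount (outputs _) = 0
gateCount (gate _ C)  = suc (gateCount C)

-- The machine turning circuits into formulas

module ToFormula where

  -- A and B hold operands of a gate, W the next wire, V the next x_i to be
  -- padded, N₁ and N₂ counters for the input faults; Rest counts the paddings to
  -- come and later the comparisons to be closed.
  pattern A    = zero
  pattern B    = suc zero
  pattern W    = suc (suc zero)
  pattern Len  = suc (suc (suc zero))
  pattern Rest = suc (suc (suc (suc zero)))
  pattern V    = suc (suc (suc (suc (suc zero))))
  pattern N₁   = suc (suc (suc (suc (suc (suc zero)))))
  pattern N₂   = suc (suc (suc (suc (suc (suc (suc zero))))))

  Template : Set
  Template = Formula (Index 8 ⊎ Index 8)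

  and-items or-items : List (Item 8)
  and-items = lit true ∷ lit true ∷ lit false ∷ []
  or-items  = lit true ∷ lit true ∷ lit true ∷ []

  -- y_0, since A is 0 when these are emitted.
  truth-template falsity-template : Template
  truth-template   = Y (one A) ∨′ ¬′ Y (one A)
  falsity-template = Y (one A) ∧′ ¬′ Y (one A)

  faultItems : ((Fin 8 → Index 8) → Template) → List (Item 8)
  faultItems φ = items (differ (Y (one W)) (φ one))
    (lit true ∷ lit true ∷ lit true ∷ items (differ (Y (Len ⊕ W)) (φ (Len ⊕_))) or-items)

  notItems andItems orItems outputItems : List (Item 8)
  notItems = faultItems λ copy → ¬′ Y (copy A)
  andItems = faultItems λ copy → Y (copy A) ∧′ Y (copy B)
  orItems  = faultItems λ copy → Y (copy A) ∨′ Y (copy B)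
  -- Only the two operands that precede the rest of the comparison. Their connectives come after the
  -- last output, once per output, which is what `Rest` counts by then.
  outputItems = items (Y (one A) ∧′ ¬′ Y (Len ⊕ A)) (items (Y (one A) ∨′ ¬′ Y (Len ⊕ A)) [])

  measure header pad constrain gateStep outputStep footer program : Prog 12

  -- The input is counted before it is read, by moving it to `tmp` and back; the second reversal
  -- undoes the first.
  measure =
    push out true ⨾ push (reg Rest) true ⨾
    while inp nonEmpty (shift inp tmp ⨾ push (reg Len) true ⨾
                        push (reg Rest) true ⨾ push (reg Rest) true ⨾ push out true ⨾ push out true) ⨾
    push out false ⨾ while tmp nonEmpty (shift tmp inp)

  -- Reading n takes n off `Rest`, which leaves the number 2ℓ + 1 - n of paddings.
  header = measure ⨾
    while inp isTrue (pop inp ⨾ push (reg V) true ⨾ push (reg N₁) true ⨾ push (reg N₂) true ⨾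
                      pop (reg Rest)) ⨾ pop inp

  pad = emit (items truth-template []) ⨾
    while (reg Rest) isTrue (pop (reg Rest) ⨾ emit (items (X (one V)) and-items) ⨾ push (reg V) true)

  -- W runs over the wires of the strategy, then over those of the opponent, and ends at n + n, the
  -- wire of the first gate.
  constrain = emit (items falsity-template []) ⨾
    while (reg N₁) isTrue (pop (reg N₁) ⨾ emit (items (differ (Y (one W)) (X (one W))) or-items) ⨾
                           push (reg W) true) ⨾
    while (reg N₂) isTrue (pop (reg N₂) ⨾ emit (items (differ (Y (one W)) (Y (Len ⊕ W))) or-items) ⨾
                           push (reg W) true)

  gateStep = pop inp ⨾
    ifTop inp isTrue
      (pop inp ⨾ ifTop inp isTrue
        (pop inp ⨾ readReg A ⨾ readReg B ⨾ emit orItems)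
        (pop inp ⨾ readReg A ⨾ readReg B ⨾ emit andItems))
      (pop inp ⨾ readReg A ⨾ emit notItems) ⨾
    clear A ⨾ clear B ⨾ push (reg W) true

  outputStep = readReg A ⨾ emit outputItems ⨾ clear A ⨾ push (reg Rest) true

  footer = pop inp ⨾ while inp nonEmpty outputStep ⨾ emit (items truth-template []) ⨾
    while (reg Rest) isTrue (pop (reg Rest) ⨾
      emit (lit true ∷ lit true ∷ lit false ∷ or-items)) ⨾
    -- The disjunction joins the faults to the comparison; the conjunction joins the result to the
    -- paddings, which were the first to be written.
    emit (lit true ∷ lit true ∷ lit true ∷ and-items)

  program = header ⨾ pad ⨾ constrain ⨾ while inp isTrue gateStep ⨾ footer

  module _ (K : ℕ) where
    open Units K

    state : Word → Word → ℕ → ℕ → ℕ → ℕ → ℕ → ℕ → ℕ → ℕ → Stacks 12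
    state i o a b w ℓ r v n₁ n₂ = ⟨ i , o , [] ∣ a ∷ b ∷ w ∷ ℓ ∷ r ∷ v ∷ n₁ ∷ n₂ ∷ [] ⟩

    shift-out-run : ∀ {τ : Stacks 9} {o} b i d →
      shift inp tmp ⊢ (b ∷ i) ∷ o ∷ d ∷ τ ⇒ i ∷ o ∷ (b ∷ d) ∷ τ within 4
    shift-out-run true  i d = then refl (pop refl ⨾ push)
    shift-out-run false i d = else refl (pop refl ⨾ push)

    shift-back-run : ∀ {τ : Stacks 9} {o} b i d →
      shift tmp inp ⊢ d ∷ o ∷ (b ∷ i) ∷ τ ⇒ (b ∷ d) ∷ o ∷ i ∷ τ within 4
    shift-back-run true  i d = then refl (pop refl ⨾ push)
    shift-back-run false i d = else refl (pop refl ⨾ push)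

    measure-run : ∀ i → let ℓ = length i in
      measure ⊢ state i [] 0 0 0 0 0 0 0 0 ⇒ state i (unary (suc (ℓ * 2)) ʳ++ []) 0 0 0 ℓ (suc (ℓ * 2)) 0 0 0
              # ℓ * 9 + 5
    measure-run i = weaken# (≤-reflexive cost)
      (push# ⨾# push# ⨾#
       drain# (λ w d → w ∷ (ones (length d * 2) ++ true ∷ []) ∷ d ∷ [] ∷
                       [] ∷ [] ∷ [] ∷ ones (length d) ∷ ones (suc (length d * 2)) ∷ [] ∷ [] ∷ [] ∷ [])
         (λ _ _ _ → refl) (λ _ → refl)
         (λ b w d → primitive# 4 (shift-out-run b w d) ⨾# push# ⨾# push# ⨾# push# ⨾# push# ⨾# push#) i [] ⨾#
       push# ⨾#
       start# measured
         (finish# (cong (λ j → state j (unary (suc (ℓ * 2)) ʳ++ []) 0 0 0 ℓ (suc (ℓ * 2)) 0 0 0) restored)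
           (drain# (λ w d → d ∷ (unary (suc (ℓ * 2)) ʳ++ []) ∷ w ∷ [] ∷
                       [] ∷ [] ∷ [] ∷ ones ℓ ∷ ones (suc (ℓ * 2)) ∷ [] ∷ [] ∷ [] ∷ [])
             (λ _ _ _ → refl) (λ _ → refl) (λ b w d → primitive# 4 (shift-back-run b w d)) (i ʳ++ []) [])))
      where
      ℓ = length i
      same-length : length (i ʳ++ []) ≡ ℓ
      same-length = trans (length-ʳ++ i) (+-identityʳ ℓ)
      restored : (i ʳ++ []) ʳ++ [] ≡ i
      restored = trans (ʳ++-ʳ++ i) (++-identityʳ i)
      measured : _≡_ {A = Stacks 12}
        ([] ∷ (false ∷ ones (length (i ʳ++ []) * 2) ++ true ∷ []) ∷ (i ʳ++ []) ∷ [] ∷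
         [] ∷ [] ∷ [] ∷ ones (length (i ʳ++ [])) ∷ ones (suc (length (i ʳ++ []) * 2)) ∷ [] ∷ [] ∷ [] ∷ [])
        ([] ∷ (unary (suc (ℓ * 2)) ʳ++ []) ∷ (i ʳ++ []) ∷ [] ∷
         [] ∷ [] ∷ [] ∷ ones ℓ ∷ ones (suc (ℓ * 2)) ∷ [] ∷ [] ∷ [] ∷ [])
      measured = cong₂ (λ o l → [] ∷ o ∷ (i ʳ++ []) ∷ [] ∷
                                [] ∷ [] ∷ [] ∷ ones l ∷ ones (suc (l * 2)) ∷ [] ∷ [] ∷ [] ∷ [])
        (trans (cong (λ l → false ∷ ones (l * 2) ++ true ∷ []) same-length)
               (sym (unary-ʳ++ (ℓ * 2) (true ∷ []))))
        same-length
      open +-*-Solver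
      cost : 1 + (1 + (ℓ * 7 + 1 + (1 + (length (i ʳ++ []) * 2 + 1)))) ≡ ℓ * 9 + 5
      cost = trans (cong (λ l → 1 + (1 + (ℓ * 7 + 1 + (1 + (l * 2 + 1))))) same-length)
        (solve 1 (λ ℓ → con 1 :+ (con 1 :+ (ℓ :* con 7 :+ con 1 :+ (con 1 :+ (ℓ :* con 2 :+ con 1))))
                     := ℓ :* con 9 :+ con 5) refl ℓ)

    header-run : ∀ {i} n r → let w = unary n ++ i ; ℓ = length w in n + r ≡ suc (ℓ * 2) →
      header ⊢ state w [] 0 0 0 0 0 0 0 0 ⇒ state i (unary (suc (ℓ * 2)) ʳ++ []) 0 0 0 ℓ r n n n
             # ℓ * 9 + 5 + (n * 6 + 2)
    header-run {i} n r eq = weaken# (+-monoʳ-≤ (ℓ * 9 + 5) (≤-reflexive (+-assoc (n * 6) 1 1)))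
      (measure-run w ⨾#
       start# (cong (λ s → state w o 0 0 0 ℓ s 0 0 0) (sym eq))
         (countdown# n (λ x d → state (unary x ++ i) o 0 0 0 ℓ (x + r) d d d) (λ _ _ → refl) (λ _ → refl)
            (λ _ _ _ → pop# refl ⨾# push# ⨾# push# ⨾# push# ⨾# pop# refl) ⨾#
          pop# refl))
      where
      w = unary n ++ i
      ℓ = length w
      o = unary (suc (ℓ * 2)) ʳ++ []

    module _ {ℓ} (2ℓ<K : suc (ℓ * 2) ≤ K) where
      open Encoding ℓ

      ℓ≤K : ℓ ≤ K
      ℓ≤K = ≤-trans (≤-double ℓ ≤-refl) (<⇒≤ 2ℓ<K)

      pad-run : ∀ {i o} n r → r + n ≡ suc (ℓ * 2) →
        pad ⊢ state i o 0 0 0 ℓ r n n n ⇒ state i (code (paddings n r) o) 0 0 0 ℓ 0 (r + n) n n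
            # 14 + (r * 11 + 1)
      pad-run {i} {o} n r eq =
        emit# (z≤n ∷ z≤n ∷ z≤n ∷ ℓ≤K ∷ r≤K ∷ n≤K ∷ n≤K ∷ n≤K ∷ []) (items truth-template []) ⨾#
        countdown# r (λ w d → state i (code (paddings n d) o) 0 0 0 ℓ w (d + n) n n)
          (λ _ _ → refl) (λ _ → refl)
          (λ w d e → pop# refl ⨾#
            emit# (z≤n ∷ z≤n ∷ z≤n ∷ ℓ≤K ∷ ≤-trans (remaining≤ e) r≤K ∷
                   ≤-trans (+-monoˡ-≤ n (elapsed≤ e)) r+n≤K ∷ n≤K ∷ n≤K ∷ [])
                  (items (X (one V)) and-items) ⨾#
            push#)
        where
        r+n≤K = ≤-trans (≤-reflexive eq) 2ℓ<K
        r≤K = ≤-trans (m≤m+n r n) r+n≤K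
        n≤K = ≤-trans (m≤n+m n r) r+n≤K

      constrain-run : ∀ {i o v} n → n + n ≤ ℓ → v ≤ K →
        constrain ⊢ state i o 0 0 0 ℓ 0 v n n ⇒ state i (code (inputFaults n) o) 0 0 (n + n) ℓ 0 v 0 0
                  # 14 + (n * 36 + 1 + (n * 38 + 1))
      constrain-run {i} {o} {v} n 2n≤ℓ v≤K =
        emit# (bounds z≤n n≤K n≤K) (items falsity-template []) ⨾#
        countdown# n (λ w d → state i (code (range (strategyFault n) falsity d) o) 0 0 d ℓ 0 v w n)
          (λ _ _ → refl) (λ _ → refl)
          (λ w d e → pop# refl ⨾#
            emit# (bounds (≤-trans (elapsed≤ e) n≤K) (≤-trans (remaining≤ e) n≤K) n≤K)
                  (items (differ (Y (one W)) (X (one W))) or-items) ⨾#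
            push#) ⨾#
        countdown# n (λ w d → state i (code (range (sharedFault n) (range (strategyFault n) falsity n) d) o)
                                   0 0 (d + n) ℓ 0 v 0 w)
          (λ _ _ → refl) (λ _ → refl)
          (λ w d e → pop# refl ⨾#
            emit# (bounds (≤-trans (+-monoˡ-≤ n (elapsed≤ e)) 2n≤K) z≤n (≤-trans (remaining≤ e) n≤K))
                  (items (differ (Y (one W)) (Y (Len ⊕ W))) or-items) ⨾#
            push#)
        where
        2n≤K = ≤-trans 2n≤ℓ ℓ≤K
        n≤K = ≤-trans (m≤m+n n n) 2n≤K
        bounds : ∀ {w n₁ n₂} → w ≤ K → n₁ ≤ K → n₂ ≤ K →
                 Bounded (0 ∷ 0 ∷ w ∷ ℓ ∷ 0 ∷ v ∷ n₁ ∷ n₂ ∷ [])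
        bounds w≤K n₁≤K n₂≤K = z≤n ∷ z≤n ∷ w≤K ∷ ℓ≤K ∷ z≤n ∷ v≤K ∷ n₁≤K ∷ n₂≤K ∷ []

      bounds : ∀ {a b w r v} → a ≤ K → b ≤ K → w ≤ K → r ≤ K → v ≤ K →
               Bounded (a ∷ b ∷ w ∷ ℓ ∷ r ∷ v ∷ 0 ∷ 0 ∷ [])
      bounds a≤K b≤K w≤K r≤K v≤K = a≤K ∷ b≤K ∷ w≤K ∷ ℓ≤K ∷ r≤K ∷ v≤K ∷ z≤n ∷ z≤n ∷ []

      toℕ≤K : ∀ (j : Fin m) → m ≤ K → toℕ j ≤ K
      toℕ≤K j m≤K = ≤-trans (<⇒≤ (toℕ<n j)) m≤K

      readBoth : ∀ {p i o v τ c} (j₁ j₂ : Fin m) → m ≤ K →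
        p ⊢ state i o (toℕ j₁) (toℕ j₂) m ℓ 0 v 0 0 ⇒ τ # c →
        readReg A ⨾ readReg B ⨾ p ⊢ state ((encodeFin j₁ ++ encodeFin j₂) ++ i) o 0 0 m ℓ 0 v 0 0 ⇒ τ # 2 + c
      readBoth {m} {i = i} {o} {v} j₁ j₂ m≤K r =
        start# (cong (λ u → state u o 0 0 m ℓ 0 v 0 0) (++-assoc (encodeFin j₁) (encodeFin j₂) i))
          (readReg# (0 ∷ 0 ∷ m ∷ ℓ ∷ 0 ∷ v ∷ 0 ∷ 0 ∷ []) A (toℕ j₁) refl (toℕ≤K j₁ m≤K) ⨾#
           readReg# (toℕ j₁ ∷ 0 ∷ m ∷ ℓ ∷ 0 ∷ v ∷ 0 ∷ 0 ∷ []) B (toℕ j₂) refl (toℕ≤K j₂ m≤K) ⨾# r)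

      finishGate : ∀ {i o a b v} → a ≤ K → b ≤ K →
        clear A ⨾ clear B ⨾ push (reg W) true ⊢ state i o a b m ℓ 0 v 0 0
                                            ⇒ state i o 0 0 (suc m) ℓ 0 v 0 0 # 3
      finishGate {m} {a = a} {b} {v} a≤K b≤K =
        clear# (a ∷ b ∷ m ∷ ℓ ∷ 0 ∷ v ∷ 0 ∷ 0 ∷ []) A a≤K ⨾#
        clear# (0 ∷ b ∷ m ∷ ℓ ∷ 0 ∷ v ∷ 0 ∷ 0 ∷ []) B b≤K ⨾# push#

      gateStep-run : ∀ {i o v} acc (g : Gate m) → m ≤ K → v ≤ K →
        gateStep ⊢ state (true ∷ encodeGate g ++ i) (code acc o) 0 0 m ℓ 0 v 0 0
                 ⇒ state i (code (addFaults acc g) o) 0 0 (suc m) ℓ 0 v 0 0 # 120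
      gateStep-run {m} {v = v} acc (NOT j) m≤K v≤K = weaken# (≤ᵇ⇒≤ _ 120 tt)
        (pop# refl ⨾#
         else# refl (pop# refl ⨾#
           readReg# (0 ∷ 0 ∷ m ∷ ℓ ∷ 0 ∷ v ∷ 0 ∷ 0 ∷ []) A (toℕ j) refl (toℕ≤K j m≤K) ⨾#
           emit# (bounds (toℕ≤K j m≤K) z≤n m≤K z≤n v≤K) notItems) ⨾#
         finishGate (toℕ≤K j m≤K) z≤n)
      gateStep-run acc (AND j₁ j₂) m≤K v≤K = weaken# (≤ᵇ⇒≤ _ 120 tt)
        (pop# refl ⨾#
         then# refl (pop# refl ⨾# else# refl (pop# refl ⨾# readBoth j₁ j₂ m≤K
           (emit# (bounds (toℕ≤K j₁ m≤K) (toℕ≤K j₂ m≤K) m≤K z≤n v≤K) andItems))) ⨾#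
         finishGate (toℕ≤K j₁ m≤K) (toℕ≤K j₂ m≤K))
      gateStep-run acc (OR j₁ j₂) m≤K v≤K = weaken# (≤ᵇ⇒≤ _ 120 tt)
        (pop# refl ⨾#
         then# refl (pop# refl ⨾# then# refl (pop# refl ⨾# readBoth j₁ j₂ m≤K
           (emit# (bounds (toℕ≤K j₁ m≤K) (toℕ≤K j₂ m≤K) m≤K z≤n v≤K) orItems))) ⨾#
         finishGate (toℕ≤K j₁ m≤K) (toℕ≤K j₂ m≤K))

      -- The number of wires changes down to the outputs, so the final state is quantified
      -- existentially. The equation lets the footer complete exactly `simulation acc C`.
      circuit-run : ∀ {o v} (C : Circuit m k) acc → wireCount C ≤ ℓ → v ≤ K →
        ∃[ m′ ] ∃[ acc′ ] ∃[ os ] simulation acc C ≡ acc′ ∨′ geq {m′} {k} os × m′ ≤ ℓ ×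
          while inp isTrue gateStep ⊢ state (encodeCircuit C) (code acc o) 0 0 m ℓ 0 v 0 0
            ⇒ state (false ∷ encodeOutputs os) (code acc′ o) 0 0 m′ ℓ 0 v 0 0 # gateCount C * 121 + 1
      circuit-run {m} (outputs os) acc w≤ℓ v≤K = m , acc , os , refl , w≤ℓ , exit# refl
      circuit-run (gate g C) acc w≤ℓ v≤K =
        let m′ , acc′ , os , eq , m′≤ℓ , r = circuit-run C (addFaults acc g) w≤ℓ v≤K
            m≤K = ≤-trans (<⇒≤ (≤-trans (≤-wireCount C) w≤ℓ)) ℓ≤K
        in m′ , acc′ , os , eq , m′≤ℓ , loop# refl (gateStep-run acc g m≤K v≤K) r

      comparisons : Vec (Fin m) k → Word → Word
      comparisons []       o = o
      comparisons (j ∷ os) o = comparisons os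
        (code (Y (toℕ j) ∨′ ¬′ Y (ℓ + toℕ j)) (code (Y (toℕ j) ∧′ ¬′ Y (ℓ + toℕ j)) o))

      closings : ℕ → Word → Word
      closings zero    o = o
      closings (suc k) o = true ∷ true ∷ true ∷ false ∷ true ∷ true ∷ closings k o

      -- Since `geq` nests to the right, all operands precede all connectives in postfix, and two
      -- separate loops can write them.
      geq-code : ∀ (os : Vec (Fin m) k) o → code (geq os) o ≡ closings k (code truth (comparisons os o))
      geq-code []       o = refl
      geq-code (j ∷ os) o = cong (λ w → true ∷ true ∷ true ∷ false ∷ true ∷ true ∷ w) (geq-code os _)

      nonEmpty-unary : ∀ j w → nonEmpty (List.head (unary j ++ w)) ≡ true
      nonEmpty-unary zero    w = refl
      nonEmpty-unary (suc j) w = refl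

      outputs-run : ∀ {o w v} (os : Vec (Fin m) k) c → m ≤ K → w ≤ K → v ≤ K → k + c ≤ K →
        while inp nonEmpty outputStep ⊢ state (encodeOutputs os) o 0 0 w ℓ c v 0 0
          ⇒ state [] (comparisons os o) 0 0 w ℓ (k + c) v 0 0 # k * 41 + 1
      outputs-run [] c _ _ _ _ = exit# refl
      outputs-run {k = suc k} {o} {w} {v} (j ∷ os) c m≤K w≤K v≤K k+c≤K =
        loop# (nonEmpty-unary (toℕ j) (encodeOutputs os)) (weaken# (≤ᵇ⇒≤ _ 40 tt)
          (readReg# (0 ∷ 0 ∷ w ∷ ℓ ∷ c ∷ v ∷ 0 ∷ 0 ∷ []) A (toℕ j) refl (toℕ≤K j m≤K) ⨾#
           emit# (bounds (toℕ≤K j m≤K) z≤n w≤K (≤-trans (m≤n+m c (suc k)) k+c≤K) v≤K) outputItems ⨾#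
           clear# (toℕ j ∷ 0 ∷ w ∷ ℓ ∷ c ∷ v ∷ 0 ∷ 0 ∷ []) A (toℕ≤K j m≤K) ⨾# push#))
        (finish# (cong (λ x → state [] (comparisons (j ∷ os) o) 0 0 w ℓ x v 0 0) (+-suc k c))
          (outputs-run os (suc c) m≤K w≤K v≤K (subst (_≤ K) (sym (+-suc k c)) k+c≤K)))

      footer-run : ∀ {o m v} P acc (os : Vec (Fin m) k) → m ≤ K → v ≤ K → k ≤ K →
        footer ⊢ state (false ∷ encodeOutputs os) (code acc (code P o)) 0 0 m ℓ 0 v 0 0
          ⇒ state [] (code (P ∧′ (acc ∨′ geq os)) o) 0 0 m ℓ 0 v 0 0
          # 1 + (k * 41 + 1 + (14 + (k * 9 + 1 + 7)))
      footer-run {k} {o} {m} {v} P acc os m≤K v≤K k≤K =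
        pop# refl ⨾#
        finish# (cong (λ c → state [] (comparisons os (code acc (code P o))) 0 0 m ℓ c v 0 0) (+-identityʳ k))
          (outputs-run os 0 m≤K m≤K v≤K (subst (_≤ K) (sym (+-identityʳ k)) k≤K)) ⨾#
        emit# (bounds z≤n z≤n m≤K k≤K v≤K) (items truth-template []) ⨾#
        countdown# k
          (λ c d → state [] (closings d (code truth (comparisons os (code acc (code P o))))) 0 0 m ℓ c v 0 0)
          (λ _ _ → refl) (λ _ → refl)
          (λ c d e → pop# refl ⨾#
            emit# (bounds z≤n z≤n m≤K
                     (≤-trans (remaining≤ e) k≤K) v≤K)
                  (lit true ∷ lit true ∷ lit false ∷ or-items)) ⨾#
        finish# (cong (λ w → state [] (false ∷ true ∷ true ∷ true ∷ true ∷ true ∷ w) 0 0 m ℓ 0 v 0 0)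
                      (sym (geq-code os (code acc (code P o)))))
          (emit# (bounds z≤n z≤n m≤K z≤n v≤K) (lit true ∷ lit true ∷ lit true ∷ and-items))

  unary-length : ∀ i → 1 ≤ length (unary i)
  unary-length zero    = ≤-refl
  unary-length (suc i) = s≤s z≤n

  outputs-length : ∀ (os : Vec (Fin m) k) → k ≤ length (encodeOutputs os)
  outputs-length []       = z≤n
  outputs-length (j ∷ os) = subst (_ ≤_) (sym (length-++ (encodeFin j)))
    (+-mono-≤ (unary-length (toℕ j)) (outputs-length os))

  -- Every gate and every output takes at least one bit. The outputs are counted because a circuit
  -- has 2n input wires but only n + 1 bits announce n; its n outputs make up for the difference.
  wireCount-length : ∀ (C : Circuit m k) → wireCount C + k ≤ m + length (encodeCircuit C)
  wireCount-length {m} (outputs os) = +-monoʳ-≤ m (m≤n⇒m≤1+n (outputs-length os))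
  wireCount-length {m} {k} (gate g C) = begin
    wireCount C + k                     ≤⟨ wireCount-length C ⟩
    suc m + length (encodeCircuit C)    ≤⟨ +-monoʳ-≤ (suc m) (length-suffix (encodeGate g) (encodeCircuit C)) ⟩
    suc m + length (encodeGate g ++ encodeCircuit C) ≡⟨ +-suc m _ ⟨
    m + length (encodeCircuit (gate g C)) ∎
    where open ≤-Reasoning

  gateCount-length : ∀ (C : Circuit m k) → gateCount C ≤ length (encodeCircuit C)
  gateCount-length (outputs _) = z≤n
  gateCount-length (gate g C)  = s≤s (≤-trans (gateCount-length C) (length-suffix (encodeGate g) (encodeCircuit C)))

  module _ n (C : Circuit (n + n) n) where

    ℓ r K : ℕ
    ℓ = length (unary n ++ encodeCircuit C)
    r = suc (ℓ * 2) ∸ n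
    K = 2 * suc ℓ

    ℓ≡ : ℓ ≡ suc n + length (encodeCircuit C)
    ℓ≡ = length-unary n (encodeCircuit C)

    n≤ℓ : n ≤ ℓ
    n≤ℓ = subst (n ≤_) (sym ℓ≡) (≤-trans (n≤1+n n) (m≤m+n (suc n) _))

    gates≤ℓ : gateCount C ≤ ℓ
    gates≤ℓ = subst (gateCount C ≤_) (sym ℓ≡) (≤-trans (gateCount-length C) (m≤n+m _ (suc n)))

    wireCount≤ℓ : wireCount C ≤ ℓ
    wireCount≤ℓ = +-cancelʳ-≤ n _ _ (begin
      wireCount C + n                           ≤⟨ wireCount-length C ⟩
      n + n + length (encodeCircuit C)          ≡⟨ +-assoc n n _ ⟩
      n + (n + length (encodeCircuit C))        ≤⟨ +-monoʳ-≤ n (n≤1+n _) ⟩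
      n + (suc n + length (encodeCircuit C))    ≡⟨ cong (n +_) ℓ≡ ⟨
      n + ℓ                                     ≡⟨ +-comm n ℓ ⟩
      ℓ + n                                     ∎)
      where open ≤-Reasoning

    r+n : r + n ≡ suc (ℓ * 2)
    r+n = m∸n+n≡m (≤-trans n≤ℓ (m≤n⇒m≤1+n (≤-double ℓ ≤-refl)))

    2ℓ<K : suc (ℓ * 2) ≤ K
    2ℓ<K = ≤-trans (n≤1+n _) (≤-reflexive (*-comm (suc ℓ) 2))

    -- A record rather than a function, so that a and x can be inferred.
    record _≼_ (a x : ℕ) : Set where
      constructor scaled
      field bound : a ≤ x * suc ℓ

    infix 4 _≼_
    infixl 6 _⊞_

    _⊞_ : ∀ {a b x y} → a ≼ x → b ≼ y → a + b ≼ x + y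
    _⊞_ {x = x} {y} (scaled p) (scaled q) =
      scaled (≤-trans (+-mono-≤ p q) (≤-reflexive (sym (*-distribʳ-+ (suc ℓ) x y))))

    at-most : ∀ {a x} y → x ≤ y → a ≼ x → a ≤ y * suc ℓ
    at-most y x≤y (scaled p) = ≤-trans p (*-monoˡ-≤ (suc ℓ) x≤y)

    const : ∀ c → c ≼ c
    const c = scaled (m≤m*n c (suc ℓ))

    linear : ∀ {a} c → a ≤ ℓ → a * c ≼ c
    linear {a} c a≤ℓ = scaled (≤-trans (*-monoˡ-≤ c (m≤n⇒m≤1+n a≤ℓ)) (≤-reflexive (*-comm (suc ℓ) c)))

    -- The constant c is a variable because c * suc ℓ unfolds if c is a numeral.
    program-run : ∀ c → 400 ≤ c → ∃[ σ ] Units._⊢_⇒_#_ K program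
      ⟨ unary n ++ encodeCircuit C , [] , [] ∣ Vec.replicate 8 0 ⟩
      ([] ∷ code (Encoding.dominanceFormula ℓ n C r) (unary (suc (ℓ * 2)) ʳ++ []) ∷ σ) (c * suc ℓ)
    program-run c 400≤c
      with circuit-run K 2ℓ<K {o = code (Encoding.paddings ℓ n r) (unary (suc (ℓ * 2)) ʳ++ [])} {v = r + n}
             C (Encoding.inputFaults ℓ n) wireCount≤ℓ (≤-trans (≤-reflexive r+n) 2ℓ<K)
    ... | m , acc , os , eq , m≤ℓ , simulate-run = _ , weaken# cost
      (header-run K n r (trans (+-comm n r) r+n) ⨾#
       pad-run K 2ℓ<K n r r+n ⨾#
       constrain-run K 2ℓ<K n (≤-trans (≤-wireCount C) wireCount≤ℓ) v≤K ⨾#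
       simulate-run ⨾#
       finish# (cong (λ φ → state K [] (code (P ∧′ φ) (unary (suc (ℓ * 2)) ʳ++ [])) 0 0 m ℓ 0 (r + n) 0 0) (sym eq))
         (footer-run K 2ℓ<K P acc os (≤-trans m≤ℓ (ℓ≤K K 2ℓ<K)) v≤K (≤-trans n≤ℓ (ℓ≤K K 2ℓ<K))))
      where
      open Units K
      P = Encoding.paddings ℓ n r
      v≤K = ≤-trans (≤-reflexive r+n) 2ℓ<K
      cost : ℓ * 9 + 5 + (n * 6 + 2) +
             (14 + (r * 11 + 1) +
             (14 + (n * 36 + 1 + (n * 38 + 1)) +
             (gateCount C * 121 + 1 +
             (1 + (n * 41 + 1 + (14 + (n * 9 + 1 + 7))))))) ≤ c * suc ℓ
      -- The coefficients add up to 345, and 400 is a round number above; evaluation checks it.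
      cost = at-most c (≤-trans (≤ᵇ⇒≤ _ 400 tt) 400≤c)
        (linear 9 ≤-refl ⊞ const 5 ⊞ (linear 6 n≤ℓ ⊞ const 2) ⊞
         (const 14 ⊞ (r≤ ⊞ const 1) ⊞
         (const 14 ⊞ (linear 36 n≤ℓ ⊞ const 1 ⊞ (linear 38 n≤ℓ ⊞ const 1)) ⊞
         (linear 121 gates≤ℓ ⊞ const 1 ⊞
         (const 1 ⊞ (linear 41 n≤ℓ ⊞ const 1 ⊞ (const 14 ⊞ (linear 9 n≤ℓ ⊞ const 1 ⊞ const 7))))))))
        where
        r≤ : r * 11 ≼ 22
        r≤ = scaled (begin
          r * 11             ≤⟨ *-monoˡ-≤ 11 (m∸n≤m (suc (ℓ * 2)) n) ⟩
          suc (ℓ * 2) * 11   ≤⟨ *-monoˡ-≤ 11 (n≤1+n (suc (ℓ * 2))) ⟩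
          suc ℓ * 2 * 11     ≡⟨ *-assoc (suc ℓ) 2 11 ⟩
          suc ℓ * 22         ≡⟨ *-comm (suc ℓ) 22 ⟩
          22 * suc ℓ         ∎)
          where open ≤-Reasoning

module Reduction where
  open ToFormula using (ℓ; r; wireCount≤ℓ; r+n)

  raw : ∀ n → Circuit (n + n) n → Raw
  raw n C = Encoding.dominanceFormula (ℓ n C) n C (r n C)

  formula : Instance WDom-Strategy → Instance U∃∀-Sat
  formula (n , C) = suc (ℓ n C * 2) , scope (raw n C)

  encoded : ∀ n C → encode U∃∀-Sat (formula (n , C)) ʳ++ [] ≡ code (raw n C) (unary (suc (ℓ n C * 2)) ʳ++ [])
  encoded n C = trans (++-ʳ++ (unary (suc (ℓ n C * 2))) {encodeFormula (scope (raw n C))})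
    (encode-code (raw n C) (unary (suc (ℓ n C * 2)) ʳ++ [])
      (below-dominanceFormula (ℓ n C) C (r n C) (wireCount≤ℓ n C) (r+n n C)))

  formula-correct : ∀ i → Yes WDom-Strategy i ⇔ Yes U∃∀-Sat (formula i)
  formula-correct (n , C) = Dominance.dominance-correct C (wireCount≤ℓ n C) (r+n n C)

  run : ∀ c → 400 ≤ c → ∀ i → let w = encode WDom-Strategy i in
    ∃[ σ ] Units._⊢_⇒_#_ (2 * suc (length w)) ToFormula.program ⟨ w , [] , [] ∣ Vec.replicate 8 0 ⟩
      ([] ∷ (encode U∃∀-Sat (formula i) ʳ++ []) ∷ σ) (c * suc (length w))
  run c 400≤c (n , C) =
    let σ , r = ToFormula.program-run n C c 400≤c
    in σ , Units.finish# (2 * suc (ℓ n C)) (cong (λ o → [] ∷ o ∷ σ) (sym (encoded n C))) r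

  reduction : ∀ c → 400 ≤ c → WDom-Strategy ≤ₚ U∃∀-Sat
  reduction c 400≤c = formula ,
    polynomialTime {P = WDom-Strategy} {Q = U∃∀-Sat} {f = formula} ToFormula.program c (run c 400≤c) ,
    formula-correct

theorem8p2 : U∃∀-Sat ≡ₚ WDom-Strategy
theorem8p2 = U∃∀-Sat≤WDom , Reduction.reduction 400 ≤-refl
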